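{- For any integer $n\geq 1$, $$N_{n}(t)=\left(\frac{1+yt}{1+y}\right)^{n+1}T_{n}^{(\mathrm{tc},\mathrm{nlc})}\left(\frac{(1+y)^{2}t}{(y+t)(1+yt)},\frac{y+t}{1+yt}\right).$$ Equivalently, $$T_{n}^{(\mathrm{tc},\mathrm{nlc})}(y,t)=\left(\frac{1+u}{1+uv}\right)^{n+1}N_{n}(v),$$ where $$u=\frac{1+t^{2}-2yt-(1-t)\sqrt{(1+t)^{2}-4yt}}{2(1-y)t},\qquad v=\frac{(1+t)^{2}-2yt-(1+t)\sqrt{(1+t)^{2}-4yt}}{2yt}.$$ Furthermore, $$T_{n}^{(\mathrm{tc},\mathrm{nlc})}(y,t)=\sum_{k=0}^{\lfloor (n-1)/2\rfloor}\frac{1}{k+1}\binom{2k}{k}\binom{n-1}{2k}y^{k+1}t^{k+1}(1+t)^{n-2k-1},$$ and the number of binary trees with $n$ nodes, $k$ nodes with two children, and $j$ nodes with no left children is $$\frac{1}{k+1}\binom{2k}{k}\binom{n-1}{2k}\binom{n-2k-1}{j-k-1}.$$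
   Context: A binary tree is a rooted tree in which each node has $0$, $1$ or $2$ children and each child is distinguished as a left child or a right child (each node having at most one left child and at most one right child). $\mathcal{T}_n$ is the set of binary trees with $n$ nodes. For a binary tree $T$, $\mathrm{nlc}(T)$ is the number of nodes of $T$ with no left child and $\mathrm{tc}(T)$ is the number of nodes of $T$ with two children. For $n\ge1$, $T_n^{(\mathrm{tc},\mathrm{nlc})}(y,t)=\sum_{T\in\mathcal{T}_n}y^{\mathrm{tc}(T)+1}t^{\mathrm{nlc}(T)}$, and the $n$th Narayana polynomial is $N_n(t)=\frac1n\sum_{k=1}^n\binom nk\binom n{k-1}t^k$. Binomial coefficients $\binom ab$ are $0$ when $b<0$ or when $0\le a<b$. Here $y,t$ are indeterminates; the first identity is an identity of rational functions in $y,t$. In the second identity, $\sqrt{(1+t)^2-4yt}$ is the formal power series in $t$ over $\mathbb{Q}[y]$ with constant term $1$, so that $u$ and $v$ are formal power series in $t$ with coefficients in $\mathbb{Q}[y]$. -}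

module Defs where

open import Algebra.Bundles using (CommutativeRing; RawRing; Semiring)
open import Algebra.Morphism.Structures using (IsRingHomomorphism; IsRingMonomorphism)
import Algebra.Consequences.Setoid as Consequences
import Algebra.Definitions.RawSemiring as RawSemiringDefs
import Algebra.Morphism.Construct.Composition as Composition
import Algebra.Morphism.RingMonomorphism as RingMonomorphism
import Algebra.Properties.Ring as RingProperties
import Algebra.Properties.Semiring.Sum as SemiringSum
import Algebra.Solver.Ring.NaturalCoefficients.Default as RingSolver
open import Data.Empty using (⊥)
open import Data.Fin.Base using (toℕ)
open import Data.Integer.Base using (ℤ; +_; -[1+_])
open import Data.List.Base using (List; []; _∷_; [_]; map; foldr; filter; length; cartesianProductWith)
open import Data.List.Membership.Propositional using (_∈_)
open import Data.List.Membership.Propositional.Properties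
  using (∈-filter⁺; ∈-filter⁻; ∈-cartesianProductWith⁺; ∈-cartesianProductWith⁻)
open import Data.List.Relation.Unary.All as All using ()
open import Data.List.Relation.Unary.AllPairs using ([]; _∷_)
open import Data.List.Relation.Unary.Any using (here; there)
open import Data.List.Relation.Unary.Unique.Propositional using (Unique)
open import Data.List.Relation.Unary.Unique.Propositional.Properties
  using (filter⁺; cartesianProductWith⁺)
open import Data.Nat.Base using (ℕ; zero; suc; _∸_; _⊔_; _≤_; z≤n; s≤s; NonZero)
import Data.Nat.Base as ℕ
import Data.Nat.Properties as ℕ
open import Data.Nat.Combinatorics using (_C_)
open import Data.Product.Base using (_×_; _,_; proj₁; proj₂; ∃)
open import Data.Rational.Base using (ℚ; 0ℚ; 1ℚ)
import Data.Rational.Base as ℚ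
import Data.Rational.Properties as ℚ
open import Function.Base using (_∘_)
open import Level using (0ℓ)
open import Relation.Binary.PropositionalEquality as ≡ using (_≡_; _≢_; refl)
open import Relation.Binary.Bundles using (Setoid)
open import Relation.Binary.Structures using (IsEquivalence)
open import Relation.Nullary using (¬_; Dec; yes; no)
open import Relation.Nullary.Decidable using (decidable-stable; _×-dec_)
open import Relation.Nullary.Decidable.Core using (¬¬-excluded-middle)
open import Relation.Nullary.Negation using (Stable)

-- `empty` stands for an absent child, so the rooted binary trees are the
-- values of the form `node l r`.

data BinaryTree : Set where
  empty : BinaryTree
  node  : (left right : BinaryTree) → BinaryTree

nodes : BinaryTree → ℕ
nodes empty      = 0
nodes (node l r) = suc (nodes l ℕ.+ nodes r)

nlc : BinaryTree → ℕ
nlc empty                 = 0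
nlc (node empty r)        = suc (nlc r)
nlc (node l@(node _ _) r) = nlc l ℕ.+ nlc r

tc : BinaryTree → ℕ
tc empty                              = 0
tc (node empty r)                     = tc r
tc (node l@(node _ _) empty)          = tc l
tc (node l@(node _ _) r@(node _ _))   = suc (tc l ℕ.+ tc r)

treesOfHeight≤ : ℕ → List BinaryTree
treesOfHeight≤ zero    = [ empty ]
treesOfHeight≤ (suc h) = empty ∷ cartesianProductWith node (treesOfHeight≤ h) (treesOfHeight≤ h)

-- A tree with n nodes has height at most n, so this enumerates 𝒯ₙ, each
-- tree once: see `∈-trees⁺`, `∈-trees⁻` and `trees-unique`.

trees : ℕ → List BinaryTree
trees n = filter (λ T → nodes T ℕ.≟ n) (treesOfHeight≤ n)

∈-treesOfHeight≤ : ∀ T {h} → nodes T ≤ h → T ∈ treesOfHeight≤ h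
∈-treesOfHeight≤ empty      {zero}  _       = here refl
∈-treesOfHeight≤ empty      {suc h} _       = here refl
∈-treesOfHeight≤ (node l r) {suc h} (s≤s p) = there (∈-cartesianProductWith⁺ node
  (∈-treesOfHeight≤ l (ℕ.≤-trans (ℕ.m≤m+n _ _) p))
  (∈-treesOfHeight≤ r (ℕ.≤-trans (ℕ.m≤n+m _ _) p)))

treesOfHeight≤-unique : ∀ h → Unique (treesOfHeight≤ h)
treesOfHeight≤-unique zero    = All.[] ∷ []
treesOfHeight≤-unique (suc h) =
  All.tabulate (λ T∈ → empty≢ (∈-cartesianProductWith⁻ node ts ts T∈)) ∷
  cartesianProductWith⁺ node (λ { refl → refl , refl })
    (treesOfHeight≤-unique h) (treesOfHeight≤-unique h)
  where
  ts = treesOfHeight≤ h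
  empty≢ : ∀ {T} → (∃ λ l → ∃ λ r → l ∈ ts × r ∈ ts × T ≡ node l r) → empty ≢ T
  empty≢ (_ , _ , _ , _ , refl) ()

∈-trees⁺ : ∀ {n} T → nodes T ≡ n → T ∈ trees n
∈-trees⁺ {n} T eq =
  ∈-filter⁺ (λ T → nodes T ℕ.≟ n) (∈-treesOfHeight≤ T (ℕ.≤-reflexive eq)) eq

∈-trees⁻ : ∀ {n T} → T ∈ trees n → nodes T ≡ n
∈-trees⁻ {n} T∈ = proj₂ (∈-filter⁻ (λ T → nodes T ℕ.≟ n) {xs = treesOfHeight≤ n} T∈)

trees-unique : ∀ n → Unique (trees n)
trees-unique n = filter⁺ (λ T → nodes T ℕ.≟ n) (treesOfHeight≤-unique n)

#trees : (n k j : ℕ) → ℕ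
#trees n k j = length (filter (λ T → (tc T ℕ.≟ k) ×-dec (nlc T ℕ.≟ j)) (trees n))

-- Binomial coefficients with a possibly negative lower index.  An upper
-- index n - 2k - 1 can be truncated to n ∸ 2k ∸ 1 in the presence of the
-- factor (n-1 choose 2k), which vanishes when n < 2k + 1.

_Cℤ_ : ℕ → ℤ → ℕ
a Cℤ (+ b)    = a C b
a Cℤ -[1+ _ ] = 0

record ℚ-Algebra : Set₁ where
  field
    commutativeRing : CommutativeRing 0ℓ 0ℓ
  open CommutativeRing commutativeRing public
  field
    ι      : ℚ → Carrier
    ι-homo : IsRingHomomorphism ℚ.+-*-rawRing rawRing ι
  open RawSemiringDefs (Semiring.rawSemiring semiring) public using (_^_)
  open SemiringSum semiring public using (sum-syntax; sum⁺-syntax)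
  2# 4# : Carrier
  2# = 1# + 1#
  4# = 2# + 2#

-- Tₙ and Nₙ are polynomials with rational coefficients; at arbitrary
-- elements of a ℚ-algebra, the defining sums give their values under
-- substitution.

module _ (A : ℚ-Algebra) where
  open ℚ-Algebra A

  T⟨tc,nlc⟩ : ℕ → Carrier → Carrier → Carrier
  T⟨tc,nlc⟩ n y t = foldr _+_ 0# (map (λ T → y ^ (tc T ℕ.+ 1) * t ^ nlc T) (trees n))

  -- The summation index is k = i + 1.
  Narayana : (n : ℕ) .{{_ : NonZero n}} → Carrier → Carrier
  Narayana n t = ι (+ 1 ℚ./ n) *
    ∑[ i < n ] (ι (+ ((n C suc (toℕ i)) ℕ.* (n C toℕ i)) ℚ./ 1) * t ^ suc (toℕ i))

-- Stability of equality holds automatically in classical logic; it makes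
-- the constructions below integral domains constructively.

record IntegralDomain : Set₁ where
  field
    commutativeRing : CommutativeRing 0ℓ 0ℓ
  open CommutativeRing commutativeRing public
  field
    1≉0      : 1# ≉ 0#
    *-≉0     : ∀ {x y} → x ≉ 0# → y ≉ 0# → x * y ≉ 0#
    ≈-stable : ∀ {x y} → Stable (x ≈ y)

  infix 4 _IsQuotient_/_

  -- The quotient is unique, since b is cancellable.
  _IsQuotient_/_ : Carrier → Carrier → Carrier → Set
  q IsQuotient a / b = b ≉ 0# × b * q ≈ a

ℚ-domain : IntegralDomain
ℚ-domain = record
  { commutativeRing = ℚ.+-*-commutativeRing
  ; 1≉0      = λ ()
  ; *-≉0     = λ {p} {q} → *-≢0 p q
  ; ≈-stable = λ {p} {q} → decidable-stable (p ℚ.≟ q)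
  }
  where
  *-≢0 : ∀ p q → p ≢ 0ℚ → q ≢ 0ℚ → p ℚ.* q ≢ 0ℚ
  *-≢0 p q p≢0 q≢0 pq≡0 = q≢0 (begin
    q                         ≡⟨ ℚ.*-identityˡ q ⟨
    1ℚ ℚ.* q                  ≡⟨ ≡.cong (ℚ._* q) (ℚ.*-inverseˡ p) ⟨
    (ℚ.1/ p) ℚ.* p ℚ.* q      ≡⟨ ℚ.*-assoc (ℚ.1/ p) p q ⟩
    (ℚ.1/ p) ℚ.* (p ℚ.* q)    ≡⟨ ≡.cong ((ℚ.1/ p) ℚ.*_) pq≡0 ⟩
    (ℚ.1/ p) ℚ.* 0ℚ           ≡⟨ ℚ.*-zeroʳ (ℚ.1/ p) ⟩
    0ℚ                        ∎)
    where
    open ≡.≡-Reasoning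
    instance p-nonZero : ℚ.NonZero p
             p-nonZero = ℚ.≢-nonZero p≢0

module Series (D : IntegralDomain) where
  private
    module D = IntegralDomain D
    module S = SemiringSum D.semiring
  open D using () renaming (Carrier to R)
  open S using (sum⁺-syntax)
  open import Relation.Binary.Reasoning.Setoid D.setoid

  record Series : Set where
    no-eta-equality
    constructor series
    field coeff : ℕ → R
  open Series public

  infix 4 _≈ₛ_
  record _≈ₛ_ (f g : Series) : Set where
    constructor coeffwise
    field at : ∀ n → coeff f n D.≈ coeff g n
  open _≈ₛ_ public

  constant : R → ℕ → R
  constant a zero    = a
  constant a (suc _) = D.0#

  indeterminate : ℕ → R
  indeterminate 1 = D.1#
  indeterminate _ = D.0#

  infixl 7 _⊛_
  _⊛_ : (ℕ → R) → (ℕ → R) → ℕ → R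
  (f ⊛ g) n = ∑[ i ≤ n ] (f (toℕ i) D.* g (n ∸ toℕ i))

  C : R → Series
  C a = series (constant a)

  X : Series
  X = series indeterminate

  infixl 6 _+_
  infixl 7 _*_
  infix  8 -_

  _+_ _*_ : Series → Series → Series
  coeff (f + g) n = coeff f n D.+ coeff g n
  coeff (f * g)   = coeff f ⊛ coeff g

  -_ : Series → Series
  coeff (- f) n = D.- coeff f n

  0ₛ 1ₛ : Series
  0ₛ = C D.0#
  1ₛ = C D.1#

  constant-0 : ∀ n → constant D.0# n D.≈ D.0#
  constant-0 zero    = D.refl
  constant-0 (suc _) = D.refl

  private
    ⊛-cong : ∀ {f f′ g g′} → (∀ n → f n D.≈ f′ n) → (∀ n → g n D.≈ g′ n) →
             ∀ n → (f ⊛ g) n D.≈ (f′ ⊛ g′) n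
    ⊛-cong p q n = S.sum-cong-≋ {suc n} (λ i → D.*-cong (p (toℕ i)) (q (n ∸ toℕ i)))

    ⊛-distribʳ : ∀ h f g n → ((λ m → f m D.+ g m) ⊛ h) n D.≈ (f ⊛ h) n D.+ (g ⊛ h) n
    ⊛-distribʳ h f g n = D.trans
      (S.sum-cong-≋ {suc n} (λ i → D.distribʳ (h (n ∸ toℕ i)) (f (toℕ i)) (g (toℕ i))))
      (S.∑-distrib-+ {suc n} (λ i → f (toℕ i) D.* h (n ∸ toℕ i)) (λ i → g (toℕ i) D.* h (n ∸ toℕ i)))

    ⊛-scale : ∀ a f g n → ((λ m → a D.* f m) ⊛ g) n D.≈ a D.* (f ⊛ g) n
    ⊛-scale a f g n = D.trans
      (S.sum-cong-≋ {suc n} (λ i → D.*-assoc a (f (toℕ i)) (g (n ∸ toℕ i))))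
      (D.sym (S.*-distribˡ-sum {suc n} a (λ i → f (toℕ i) D.* g (n ∸ toℕ i))))

    ⊛-zeroˡ : ∀ {f} g → (∀ n → f n D.≈ D.0#) → ∀ n → (f ⊛ g) n D.≈ D.0#
    ⊛-zeroˡ g f≈0 zero    =
      D.trans (D.+-identityʳ _) (D.trans (D.*-congʳ (f≈0 0)) (D.zeroˡ _))
    ⊛-zeroˡ g f≈0 (suc n) = D.trans
      (D.+-cong (D.trans (D.*-congʳ (f≈0 0)) (D.zeroˡ _)) (⊛-zeroˡ g (f≈0 ∘ suc) n))
      (D.+-identityˡ _)

    ⊛-constantˡ : ∀ a g n → (constant a ⊛ g) n D.≈ a D.* g n
    ⊛-constantˡ a g zero    = D.+-identityʳ _
    ⊛-constantˡ a g (suc n) =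
      D.trans (D.+-congˡ (⊛-zeroˡ g (λ _ → D.refl) n)) (D.+-identityʳ _)

    ⊛-last : ∀ f g n → (f ⊛ g) (suc n) D.≈ (f ⊛ (g ∘ suc)) n D.+ f (suc n) D.* g 0
    ⊛-last f g zero    = begin
      f 0 D.* g 1 D.+ (f 1 D.* g 0 D.+ D.0#) ≈⟨ D.+-congˡ (D.+-identityʳ _) ⟩
      f 0 D.* g 1 D.+ f 1 D.* g 0            ≈⟨ D.+-congʳ (D.+-identityʳ _) ⟨
      f 0 D.* g 1 D.+ D.0# D.+ f 1 D.* g 0   ∎
    ⊛-last f g (suc n) =
      D.trans (D.+-congˡ (⊛-last (f ∘ suc) g n)) (D.sym (D.+-assoc _ _ _))

    ⊛-comm : ∀ f g n → (f ⊛ g) n D.≈ (g ⊛ f) n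
    ⊛-comm f g zero    = D.+-congʳ (D.*-comm _ _)
    ⊛-comm f g (suc n) = begin
      f 0 D.* g (suc n) D.+ ((f ∘ suc) ⊛ g) n ≈⟨ D.+-cong (D.*-comm _ _) (⊛-comm (f ∘ suc) g n) ⟩
      g (suc n) D.* f 0 D.+ (g ⊛ (f ∘ suc)) n ≈⟨ D.+-comm _ _ ⟩
      (g ⊛ (f ∘ suc)) n D.+ g (suc n) D.* f 0 ≈⟨ ⊛-last g f n ⟨
      (g ⊛ f) (suc n)                         ∎

    ⊛-assoc : ∀ f g h n → ((f ⊛ g) ⊛ h) n D.≈ (f ⊛ (g ⊛ h)) n
    ⊛-assoc f g h zero    = D.+-congʳ (begin
      (f 0 D.* g 0 D.+ D.0#) D.* h 0   ≈⟨ D.*-congʳ (D.+-identityʳ _) ⟩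
      f 0 D.* g 0 D.* h 0              ≈⟨ D.*-assoc _ _ _ ⟩
      f 0 D.* (g 0 D.* h 0)            ≈⟨ D.*-congˡ (D.+-identityʳ _) ⟨
      f 0 D.* (g 0 D.* h 0 D.+ D.0#)   ∎)
    ⊛-assoc f g h (suc n) = begin
      (f₀ D.* g 0 D.+ D.0#) D.* h (suc n) D.+ ((λ m → f₀ D.* g′ m D.+ (f′ ⊛ g) m) ⊛ h) n
        ≈⟨ D.+-cong
             (D.trans (D.*-congʳ (D.+-identityʳ _)) (D.*-assoc _ _ _))
             (D.trans (⊛-distribʳ h (λ m → f₀ D.* g′ m) (f′ ⊛ g) n)
                      (D.+-cong (⊛-scale f₀ g′ h n) (⊛-assoc f′ g h n))) ⟩
      f₀ D.* (g 0 D.* h (suc n)) D.+ (f₀ D.* (g′ ⊛ h) n D.+ (f′ ⊛ (g ⊛ h)) n)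
        ≈⟨ D.+-assoc _ _ _ ⟨
      f₀ D.* (g 0 D.* h (suc n)) D.+ f₀ D.* (g′ ⊛ h) n D.+ (f′ ⊛ (g ⊛ h)) n
        ≈⟨ D.+-congʳ (D.distribˡ _ _ _) ⟨
      f₀ D.* (g 0 D.* h (suc n) D.+ (g′ ⊛ h) n) D.+ (f′ ⊛ (g ⊛ h)) n
        ∎
      where
      f₀ = f 0
      f′ = f ∘ suc
      g′ = g ∘ suc

  commutativeRing : CommutativeRing 0ℓ 0ℓ
  commutativeRing = record
    { Carrier = Series
    ; _≈_ = _≈ₛ_
    ; _+_ = _+_
    ; _*_ = _*_
    ; -_ = -_
    ; 0# = 0ₛ
    ; 1# = 1ₛ
    ; isCommutativeRing = record
      { isRing = record
        { +-isAbelianGroup = record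
          { isGroup = record
            { isMonoid = record
              { isSemigroup = record
                { isMagma = record
                  { isEquivalence = isEquivalence
                  ; ∙-cong = λ p q → coeffwise λ n → D.+-cong (at p n) (at q n)
                  }
                ; assoc = λ f g h → coeffwise λ n → D.+-assoc _ _ _
                }
              ; identity =
                  (λ f → coeffwise λ n → D.trans (D.+-congʳ (constant-0 n)) (D.+-identityˡ _))
                , (λ f → coeffwise λ n → D.trans (D.+-congˡ (constant-0 n)) (D.+-identityʳ _))
              }
            ; inverse =
                (λ f → coeffwise λ n → D.trans (D.-‿inverseˡ _) (D.sym (constant-0 n)))
              , (λ f → coeffwise λ n → D.trans (D.-‿inverseʳ _) (D.sym (constant-0 n)))
            ; ⁻¹-cong = λ p → coeffwise λ n → D.-‿cong (at p n)
            }
          ; comm = λ f g → coeffwise λ n → D.+-comm _ _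
          }
        ; *-cong = *-cong
        ; *-assoc = λ f g h → coeffwise (⊛-assoc (coeff f) (coeff g) (coeff h))
        ; *-identity = comm∧idˡ⇒id *-comm λ f → coeffwise λ n →
            D.trans (⊛-constantˡ D.1# (coeff f) n) (D.*-identityˡ _)
        ; distrib = comm∧distrʳ⇒distr +-cong *-comm
            λ h f g → coeffwise (⊛-distribʳ (coeff h) (coeff f) (coeff g))
        }
      ; *-comm = *-comm
      }
    }
    where
    isEquivalence : IsEquivalence _≈ₛ_
    isEquivalence = record
      { refl  = coeffwise λ _ → D.refl
      ; sym   = λ p → coeffwise λ n → D.sym (at p n)
      ; trans = λ p q → coeffwise λ n → D.trans (at p n) (at q n)
      }
    setoid : Setoid 0ℓ 0ℓ
    setoid = record { isEquivalence = isEquivalence }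
    open Consequences setoid
    +-cong : ∀ {f f′ g g′} → f ≈ₛ f′ → g ≈ₛ g′ → f + g ≈ₛ f′ + g′
    +-cong p q = coeffwise λ n → D.+-cong (at p n) (at q n)
    *-cong : ∀ {f f′ g g′} → f ≈ₛ f′ → g ≈ₛ g′ → f * g ≈ₛ f′ * g′
    *-cong p q = coeffwise (⊛-cong (at p) (at q))
    *-comm : ∀ f g → f * g ≈ₛ g * f
    *-comm f g = coeffwise (⊛-comm (coeff f) (coeff g))

  private
    Zero : (ℕ → R) → Set
    Zero f = ∀ n → f n D.≈ D.0#

    ⊛-tailˡ : ∀ f g → f 0 D.≈ D.0# → Zero (f ⊛ g) → Zero ((f ∘ suc) ⊛ g)
    ⊛-tailˡ f g f₀≈0 fg≈0 n = begin
      ((f ∘ suc) ⊛ g) n                          ≈⟨ D.+-identityˡ _ ⟨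
      D.0# D.+ ((f ∘ suc) ⊛ g) n                 ≈⟨ D.+-congʳ (D.trans (D.*-congʳ f₀≈0) (D.zeroˡ _)) ⟨
      f 0 D.* g (suc n) D.+ ((f ∘ suc) ⊛ g) n    ≈⟨ fg≈0 (suc n) ⟩
      D.0#                                       ∎

    ⊛-tailʳ : ∀ f g → g 0 D.≈ D.0# → Zero (f ⊛ g) → Zero (f ⊛ (g ∘ suc))
    ⊛-tailʳ f g g₀≈0 fg≈0 n = D.trans (⊛-comm f (g ∘ suc) n)
      (⊛-tailˡ g f g₀≈0 (λ m → D.trans (⊛-comm g f m) (fg≈0 m)) n)

    ⊛-nonzero : ∀ i j f g → f i D.≉ D.0# → g j D.≉ D.0# → ¬ Zero (f ⊛ g)
    ⊛-nonzero i j f g fᵢ≉0 gⱼ≉0 fg≈0 =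
      ¬¬-excluded-middle λ f₀≈0? → ¬¬-excluded-middle λ g₀≈0? →
      cases i j fᵢ≉0 gⱼ≉0 f₀≈0? g₀≈0?
      where
      cases : ∀ i j → f i D.≉ D.0# → g j D.≉ D.0# →
              Dec (f 0 D.≈ D.0#) → Dec (g 0 D.≈ D.0#) → ⊥
      cases zero    j       fᵢ≉0 gⱼ≉0 (yes f₀≈0) _          = fᵢ≉0 f₀≈0
      cases (suc i) j       fᵢ≉0 gⱼ≉0 (yes f₀≈0) _          =
        ⊛-nonzero i j (f ∘ suc) g fᵢ≉0 gⱼ≉0 (⊛-tailˡ f g f₀≈0 fg≈0)
      cases i       zero    fᵢ≉0 gⱼ≉0 (no _)     (yes g₀≈0) = gⱼ≉0 g₀≈0
      cases i       (suc j) fᵢ≉0 gⱼ≉0 (no _)     (yes g₀≈0) =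
        ⊛-nonzero i j f (g ∘ suc) fᵢ≉0 gⱼ≉0 (⊛-tailʳ f g g₀≈0 fg≈0)
      cases i       j       _    _    (no f₀≉0)  (no g₀≉0)  =
        D.*-≉0 f₀≉0 g₀≉0 (D.trans (D.sym (D.+-identityʳ _)) (fg≈0 0))

    ≉0⇒coeff≉0 : ∀ {f} → ¬ f ≈ₛ 0ₛ → ¬ ¬ (∃ λ n → coeff f n D.≉ D.0#)
    ≉0⇒coeff≉0 f≉0 none = f≉0 (coeffwise λ n →
      D.trans (D.≈-stable (λ fₙ≉0 → none (n , fₙ≉0))) (D.sym (constant-0 n)))

  domain : IntegralDomain
  domain = record
    { commutativeRing = commutativeRing
    ; 1≉0      = λ 1≈0 → D.1≉0 (at 1≈0 0)
    ; *-≉0     = λ {f} {g} f≉0 g≉0 fg≈0 → ≉0⇒coeff≉0 f≉0 λ (i , fᵢ≉0) → ≉0⇒coeff≉0 g≉0 λ (j , gⱼ≉0) →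
        ⊛-nonzero i j (coeff f) (coeff g) fᵢ≉0 gⱼ≉0 (λ n → D.trans (at fg≈0 n) (constant-0 n))
    ; ≈-stable = λ ¬¬f≈g → coeffwise λ n → D.≈-stable (λ fₙ≉gₙ → ¬¬f≈g (λ f≈g → fₙ≉gₙ (at f≈g n)))
    }

  C-homo : IsRingHomomorphism D.rawRing (CommutativeRing.rawRing commutativeRing) C
  C-homo = record
    { isSemiringHomomorphism = record
      { isNearSemiringHomomorphism = record
        { +-isMonoidHomomorphism = record
          { isMagmaHomomorphism = record
            { isRelHomomorphism = record { cong = λ a≈b → coeffwise λ { zero → a≈b ; (suc _) → D.refl } }
            ; homo = λ a b → coeffwise λ { zero → D.refl ; (suc _) → D.sym (D.+-identityˡ _) }
            }
          ; ε-homo = coeffwise λ _ → D.refl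
          }
        ; *-homo = λ a b → coeffwise λ where
            zero    → D.sym (D.+-identityʳ _)
            (suc n) → D.sym (D.trans (⊛-constantˡ a (constant b) (suc n)) (D.zeroʳ _))
        }
      ; 1#-homo = coeffwise λ _ → D.refl
      }
    ; -‿homo = λ a → coeffwise λ
        { zero    → D.refl
        ; (suc _) → D.sym (RingProperties.-0#≈0# D.ring)
        }
    }

module Polynomial (D : IntegralDomain) where
  private
    module D = IntegralDomain D
    module S = SemiringSum D.semiring
    module P = IntegralDomain (Series.domain D)
  open D using () renaming (Carrier to R)
  open Series D using (Series; coeff; at; _⊛_; _≈ₛ_)

  record Poly : Set where
    no-eta-equality
    constructor poly
    field
      toSeries : Series
      finite   : ∃ λ d → ∀ n → d ≤ n → coeff toSeries n D.≈ D.0#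
  open Poly public

  infix 4 _≈ₚ_
  record _≈ₚ_ (p q : Poly) : Set where
    constructor asSeries
    field series≈ : toSeries p ≈ₛ toSeries q
  open _≈ₚ_ public

  C : R → Poly
  C a = poly (Series.C D a) (1 , λ { (suc _) _ → D.refl })

  X : Poly
  X = poly (Series.X D) (2 , λ { (suc (suc _)) _ → D.refl ; (suc zero) (s≤s ()) })

  infixl 6 _+_
  infixl 7 _*_
  infix  8 -_

  _+_ : Poly → Poly → Poly
  toSeries (p + q) = toSeries p P.+ toSeries q
  finite   (p + q) with d , p₀ ← finite p | e , q₀ ← finite q = d ⊔ e , λ n d⊔e≤n → D.trans
    (D.+-cong (p₀ n (ℕ.m⊔n≤o⇒m≤o d e d⊔e≤n)) (q₀ n (ℕ.m⊔n≤o⇒n≤o d e d⊔e≤n)))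
    (D.+-identityˡ _)

  _*_ : Poly → Poly → Poly
  toSeries (p * q) = toSeries p P.* toSeries q
  finite   (p * q) with d , p₀ ← finite p | e , q₀ ← finite q = d ℕ.+ e , λ n d+e≤n → D.trans
    (S.sum-cong-≋ {suc n} (λ i → term n d+e≤n (toℕ i) (toℕ i ℕ.<? d)))
    (S.sum-replicate-zero (suc n))
    where
    open ℕ.≤-Reasoning
    term : ∀ n → d ℕ.+ e ≤ n → ∀ i → Dec (i ℕ.< d) → coeff (toSeries p) i D.* coeff (toSeries q) (n ∸ i) D.≈ D.0#
    term n d+e≤n i (yes i<d) = D.trans (D.*-congˡ (q₀ (n ∸ i) (ℕ.m+n≤o⇒m≤o∸n e (begin
      e ℕ.+ i   ≤⟨ ℕ.+-monoʳ-≤ e (ℕ.<⇒≤ i<d) ⟩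
      e ℕ.+ d   ≡⟨ ℕ.+-comm e d ⟩
      d ℕ.+ e   ≤⟨ d+e≤n ⟩
      n         ∎)))) (D.zeroʳ _)
    term n d+e≤n i (no i≮d)  = D.trans (D.*-congʳ (p₀ i (ℕ.≮⇒≥ i≮d))) (D.zeroˡ _)

  -_ : Poly → Poly
  toSeries (- p) = P.- toSeries p
  finite   (- p) with d , p₀ ← finite p =
    d , λ n d≤n → D.trans (D.-‿cong (p₀ n d≤n)) (RingProperties.-0#≈0# D.ring)

  0ₚ 1ₚ : Poly
  0ₚ = C D.0#
  1ₚ = C D.1#

  rawRing : RawRing 0ℓ 0ℓ
  rawRing = record
    { Carrier = Poly ; _≈_ = _≈ₚ_ ; _+_ = _+_ ; _*_ = _*_ ; -_ = -_ ; 0# = 0ₚ ; 1# = 1ₚ }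

  toSeries-mono : IsRingMonomorphism rawRing P.rawRing toSeries
  toSeries-mono = record
    { isRingHomomorphism = record
      { isSemiringHomomorphism = record
        { isNearSemiringHomomorphism = record
          { +-isMonoidHomomorphism = record
            { isMagmaHomomorphism = record
              { isRelHomomorphism = record { cong = series≈ }
              ; homo = λ _ _ → P.refl
              }
            ; ε-homo = P.refl
            }
          ; *-homo = λ _ _ → P.refl
          }
        ; 1#-homo = P.refl
        }
      ; -‿homo = λ _ → P.refl
      }
    ; injective = asSeries
    }

  domain : IntegralDomain
  domain = record
    { commutativeRing = record
      { isCommutativeRing = RingMonomorphism.isCommutativeRing toSeries-mono P.isCommutativeRing }
    ; 1≉0      = λ 1≈0 → P.1≉0 (series≈ 1≈0)
    ; *-≉0     = λ p≉0 q≉0 pq≈0 →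
        P.*-≉0 (λ p≈0 → p≉0 (asSeries p≈0)) (λ q≈0 → q≉0 (asSeries q≈0)) (series≈ pq≈0)
    ; ≈-stable = λ ¬¬p≈q → asSeries (P.≈-stable (λ p≉q → ¬¬p≈q (λ p≈q → p≉q (series≈ p≈q))))
    }

  C-homo : IsRingHomomorphism D.rawRing rawRing C
  C-homo = record
    { isSemiringHomomorphism = record
      { isNearSemiringHomomorphism = record
        { +-isMonoidHomomorphism = record
          { isMagmaHomomorphism = record
            { isRelHomomorphism = record { cong = λ a≈b → asSeries (H.⟦⟧-cong a≈b) }
            ; homo = λ a b → asSeries (H.+-homo a b)
            }
          ; ε-homo = asSeries H.0#-homo
          }
        ; *-homo = λ a b → asSeries (H.*-homo a b)
        }
      ; 1#-homo = asSeries H.1#-homo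
      }
    ; -‿homo = λ a → asSeries (H.-‿homo a)
    }
    where module H = IsRingHomomorphism (Series.C-homo D)

module Fractions (D : IntegralDomain) where
  private module D = IntegralDomain D
  open D using () renaming (Carrier to R; _≈_ to _≈ᵈ_; _*_ to _·_; _+_ to _∔_)
  open import Relation.Binary.Reasoning.Setoid D.setoid
  open RingSolver D.commutativeSemiring using (solve; _:+_; _:*_; _:=_; con)

  infix 5 _/_[_]
  record Fraction : Set where
    no-eta-equality
    constructor _/_[_]
    field
      num   : R
      den   : R
      den≉0 : den D.≉ D.0#
  open Fraction public

  infix 4 _≈_
  record _≈_ (p q : Fraction) : Set where
    constructor cross
    field cross≈ : num p · den q ≈ᵈ num q · den p
  open _≈_ public

  infixl 6 _+_
  infixl 7 _*_
  infix  8 -_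

  _+_ _*_ : Fraction → Fraction → Fraction
  num   (p + q) = num p · den q ∔ num q · den p
  den   (p + q) = den p · den q
  den≉0 (p + q) = D.*-≉0 (den≉0 p) (den≉0 q)
  num   (p * q) = num p · num q
  den   (p * q) = den p · den q
  den≉0 (p * q) = D.*-≉0 (den≉0 p) (den≉0 q)

  -_ : Fraction → Fraction
  num   (- p) = D.- num p
  den   (- p) = den p
  den≉0 (- p) = den≉0 p

  embed : R → Fraction
  embed a = a / D.1# [ D.1≉0 ]

  private
    module RP = RingProperties D.ring

    cancel : ∀ {a b d} → d D.≉ D.0# → a · d ≈ᵈ b · d → a ≈ᵈ b
    cancel {a} {b} {d} d≉0 ad≈bd = D.≈-stable λ a≉b →
      D.*-≉0 (λ a-b≈0 → a≉b (RP.x∙y⁻¹≈ε⇒x≈y a b a-b≈0)) d≉0 (begin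
        (a D.- b) · d              ≈⟨ D.distribʳ d a (D.- b) ⟩
        a · d ∔ (D.- b) · d        ≈⟨ D.+-cong ad≈bd (D.sym (RP.-‿distribˡ-* b d)) ⟩
        b · d ∔ D.- (b · d)        ≈⟨ D.-‿inverseʳ _ ⟩
        D.0#                       ∎)

    ≈-trans : ∀ {p q r} → p ≈ q → q ≈ r → p ≈ r
    ≈-trans {p} {q} {r} (cross ad≈cb) (cross cf≈ed) = cross (cancel (den≉0 q) (begin
      a · f · d     ≈⟨ solve 3 (λ a f d → a :* f :* d := a :* d :* f) D.refl a f d ⟩
      a · d · f     ≈⟨ D.*-congʳ ad≈cb ⟩
      c · b · f     ≈⟨ solve 3 (λ c b f → c :* b :* f := c :* f :* b) D.refl c b f ⟩
      c · f · b     ≈⟨ D.*-congʳ cf≈ed ⟩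
      e · d · b     ≈⟨ solve 3 (λ e d b → e :* d :* b := e :* b :* d) D.refl e d b ⟩
      e · b · d     ∎))
      where a = num p; b = den p; c = num q; d = den q; e = num r; f = den r

    +-cong : ∀ {p p′ q q′} → p ≈ p′ → q ≈ q′ → p + q ≈ p′ + q′
    +-cong {p} {p′} {q} {q′} (cross p≈p′) (cross q≈q′) = cross (begin
      (a · d ∔ c · b) · (b′ · d′)
        ≈⟨ solve 6 (λ a b c d b′ d′ → (a :* d :+ c :* b) :* (b′ :* d′) :=
             a :* b′ :* (d :* d′) :+ c :* d′ :* (b :* b′)) D.refl a b c d b′ d′ ⟩
      a · b′ · (d · d′) ∔ c · d′ · (b · b′)
        ≈⟨ D.+-cong (D.*-congʳ p≈p′) (D.*-congʳ q≈q′) ⟩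
      a′ · b · (d · d′) ∔ c′ · d · (b · b′)
        ≈⟨ solve 6 (λ a′ b c′ d b′ d′ → a′ :* b :* (d :* d′) :+ c′ :* d :* (b :* b′) :=
             (a′ :* d′ :+ c′ :* b′) :* (b :* d)) D.refl a′ b c′ d b′ d′ ⟩
      (a′ · d′ ∔ c′ · b′) · (b · d) ∎)
      where
      a = num p; b = den p; a′ = num p′; b′ = den p′
      c = num q; d = den q; c′ = num q′; d′ = den q′

    *-cong : ∀ {p p′ q q′} → p ≈ p′ → q ≈ q′ → p * q ≈ p′ * q′
    *-cong {p} {p′} {q} {q′} (cross p≈p′) (cross q≈q′) = cross (begin
      a · c · (b′ · d′)
        ≈⟨ solve 4 (λ a c b′ d′ → a :* c :* (b′ :* d′) := a :* b′ :* (c :* d′)) D.refl a c b′ d′ ⟩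
      a · b′ · (c · d′)
        ≈⟨ D.*-cong p≈p′ q≈q′ ⟩
      a′ · b · (c′ · d)
        ≈⟨ solve 4 (λ a b c d → a :* b :* (c :* d) := a :* c :* (b :* d)) D.refl a′ b c′ d ⟩
      a′ · c′ · (b · d) ∎)
      where
      a = num p; b = den p; a′ = num p′; b′ = den p′
      c = num q; d = den q; c′ = num q′; d′ = den q′

    *-comm : ∀ p q → p * q ≈ q * p
    *-comm p q = cross
      (solve 4 (λ a b c d → a :* c :* (d :* b) := c :* a :* (b :* d)) D.refl
        (num p) (den p) (num q) (den q))

    +-comm : ∀ p q → p + q ≈ q + p
    +-comm p q = cross
      (solve 4 (λ a b c d → (a :* d :+ c :* b) :* (d :* b) := (c :* b :+ a :* d) :* (b :* d)) D.refl
        (num p) (den p) (num q) (den q))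

    +-assoc : ∀ p q r → (p + q) + r ≈ p + (q + r)
    +-assoc p q r = cross
      (solve 6 (λ a b c d e f →
        ((a :* d :+ c :* b) :* f :+ e :* (b :* d)) :* (b :* (d :* f)) :=
        (a :* (d :* f) :+ (c :* f :+ e :* d) :* b) :* (b :* d :* f)) D.refl
        (num p) (den p) (num q) (den q) (num r) (den r))

    *-assoc : ∀ p q r → (p * q) * r ≈ p * (q * r)
    *-assoc p q r = cross
      (solve 6 (λ a b c d e f →
        (a :* c :* e) :* (b :* (d :* f)) := (a :* (c :* e)) :* (b :* d :* f)) D.refl
        (num p) (den p) (num q) (den q) (num r) (den r))

    distribʳ : ∀ r p q → (p + q) * r ≈ p * r + q * r
    distribʳ r p q = cross
      (solve 6 (λ a b c d e f →
        ((a :* d :+ c :* b) :* e) :* (b :* f :* (d :* f)) :=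
        (a :* e :* (d :* f) :+ c :* e :* (b :* f)) :* (b :* d :* f)) D.refl
        (num p) (den p) (num q) (den q) (num r) (den r))

    +-identityˡ : ∀ p → embed D.0# + p ≈ p
    +-identityˡ p = cross
      (solve 2 (λ a b → (con 0 :* b :+ a :* con 1) :* b := a :* (con 1 :* b)) D.refl (num p) (den p))

    *-identityˡ : ∀ p → embed D.1# * p ≈ p
    *-identityˡ p = cross
      (solve 2 (λ a b → con 1 :* a :* b := a :* (con 1 :* b)) D.refl (num p) (den p))

    -‿inverseˡ : ∀ p → - p + p ≈ embed D.0#
    -‿inverseˡ p = cross (begin
      ((D.- a) · b ∔ a · b) · D.1#   ≈⟨ D.*-identityʳ _ ⟩
      (D.- a) · b ∔ a · b            ≈⟨ D.distribʳ b (D.- a) a ⟨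
      (D.- a ∔ a) · b                ≈⟨ D.*-congʳ (D.-‿inverseˡ a) ⟩
      D.0# · b                       ≈⟨ D.zeroˡ b ⟩
      D.0#                           ≈⟨ D.zeroˡ _ ⟨
      D.0# · (b · b)                 ∎)
      where a = num p; b = den p

    -‿cong : ∀ {p q} → p ≈ q → - p ≈ - q
    -‿cong {p} {q} (cross ad≈cb) = cross (begin
      (D.- a) · d     ≈⟨ RP.-‿distribˡ-* a d ⟨
      D.- (a · d)     ≈⟨ D.-‿cong ad≈cb ⟩
      D.- (c · b)     ≈⟨ RP.-‿distribˡ-* c b ⟩
      (D.- c) · b     ∎)
      where a = num p; b = den p; c = num q; d = den q

  commutativeRing : CommutativeRing 0ℓ 0ℓ
  commutativeRing = record
    { Carrier = Fraction
    ; _≈_ = _≈_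
    ; _+_ = _+_
    ; _*_ = _*_
    ; -_ = -_
    ; 0# = embed D.0#
    ; 1# = embed D.1#
    ; isCommutativeRing = record
      { isRing = record
        { +-isAbelianGroup = record
          { isGroup = record
            { isMonoid = record
              { isSemigroup = record
                { isMagma = record { isEquivalence = isEquivalence ; ∙-cong = +-cong }
                ; assoc = +-assoc
                }
              ; identity = comm∧idˡ⇒id +-comm +-identityˡ
              }
            ; inverse = comm∧invˡ⇒inv +-comm -‿inverseˡ
            ; ⁻¹-cong = -‿cong
            }
          ; comm = +-comm
          }
        ; *-cong = *-cong
        ; *-assoc = *-assoc
        ; *-identity = comm∧idˡ⇒id *-comm *-identityˡ
        ; distrib = comm∧distrʳ⇒distr +-cong *-comm distribʳ
        }
      ; *-comm = *-comm
      }
    }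
    where
    isEquivalence : IsEquivalence _≈_
    isEquivalence = record
      { refl  = cross D.refl
      ; sym   = λ (cross p) → cross (D.sym p)
      ; trans = ≈-trans
      }
    setoid : Setoid 0ℓ 0ℓ
    setoid = record { isEquivalence = isEquivalence }
    open Consequences setoid

  embed-homo : IsRingHomomorphism D.rawRing (CommutativeRing.rawRing commutativeRing) embed
  embed-homo = record
    { isSemiringHomomorphism = record
      { isNearSemiringHomomorphism = record
        { +-isMonoidHomomorphism = record
          { isMagmaHomomorphism = record
            { isRelHomomorphism = record { cong = λ a≈b → cross (D.*-congʳ a≈b) }
            ; homo = λ a b → cross (solve 2 (λ a b →
                (a :+ b) :* (con 1 :* con 1) := (a :* con 1 :+ b :* con 1) :* con 1) D.refl a b)
            }
          ; ε-homo = cross D.refl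
          }
        ; *-homo = λ a b → cross (solve 2 (λ a b →
            a :* b :* (con 1 :* con 1) := a :* b :* con 1) D.refl a b)
        }
      ; 1#-homo = cross D.refl
      }
    ; -‿homo = λ a → cross D.refl
    }

ℚ[y]-domain ℚ[y,t]-domain ℚ[y][[t]]-domain : IntegralDomain
ℚ[y]-domain      = Polynomial.domain ℚ-domain
ℚ[y,t]-domain    = Polynomial.domain ℚ[y]-domain
ℚ[y][[t]]-domain = Series.domain ℚ[y]-domain

ℚ[y,t] ℚ⟨y,t⟩ ℚ[y][[t]] : ℚ-Algebra

ℚ[y,t] = record
  { commutativeRing = IntegralDomain.commutativeRing ℚ[y,t]-domain
  ; ι = λ q → Polynomial.C ℚ[y]-domain (Polynomial.C ℚ-domain q)
  ; ι-homo = Composition.isRingHomomorphism (IntegralDomain.trans ℚ[y,t]-domain)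
      (Polynomial.C-homo ℚ-domain) (Polynomial.C-homo ℚ[y]-domain)
  }

ℚ⟨y,t⟩ = record
  { commutativeRing = Fractions.commutativeRing ℚ[y,t]-domain
  ; ι = λ q → Fractions.embed ℚ[y,t]-domain (ℚ-Algebra.ι ℚ[y,t] q)
  ; ι-homo = Composition.isRingHomomorphism
      (CommutativeRing.trans (Fractions.commutativeRing ℚ[y,t]-domain))
      (ℚ-Algebra.ι-homo ℚ[y,t]) (Fractions.embed-homo ℚ[y,t]-domain)
  }

ℚ[y][[t]] = record
  { commutativeRing = IntegralDomain.commutativeRing ℚ[y][[t]]-domain
  ; ι = λ q → Series.C ℚ[y]-domain (Polynomial.C ℚ-domain q)
  ; ι-homo = Composition.isRingHomomorphism (IntegralDomain.trans ℚ[y][[t]]-domain)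
      (Polynomial.C-homo ℚ-domain) (Series.C-homo ℚ[y]-domain)
  }

module RationalFunctions where
  open ℚ-Algebra ℚ[y,t] public
  module ℚ⟨y,t⟩ = ℚ-Algebra ℚ⟨y,t⟩
  open Fractions ℚ[y,t]-domain public using (_/_[_]; embed)

  y t : Carrier
  y = Polynomial.C ℚ[y]-domain (Polynomial.X ℚ-domain)
  t = Polynomial.X ℚ[y]-domain

  open Polynomial ℚ[y]-domain using () renaming (series≈ to in-t)
  open Polynomial ℚ-domain using () renaming (series≈ to in-y)
  open Series ℚ[y]-domain using () renaming (at to t-coeff)
  open Series ℚ-domain using () renaming (at to y-coeff)

  1+y≉0 : 1# + y ≉ 0#
  1+y≉0 eq with () ← y-coeff (in-y (t-coeff (in-t eq) 0)) 0

  y+t≉0 : y + t ≉ 0#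
  y+t≉0 eq with () ← y-coeff (in-y (t-coeff (in-t eq) 1)) 0

  1+yt≉0 : 1# + y * t ≉ 0#
  1+yt≉0 eq with () ← y-coeff (in-y (t-coeff (in-t eq) 0)) 0

  [y+t][1+yt]≉0 : (y + t) * (1# + y * t) ≉ 0#
  [y+t][1+yt]≉0 = IntegralDomain.*-≉0 ℚ[y,t]-domain y+t≉0 1+yt≉0

module PowerSeries where
  open ℚ-Algebra ℚ[y][[t]] public
  open IntegralDomain ℚ[y][[t]]-domain public using (_IsQuotient_/_)
  open Series ℚ[y]-domain using (coeff)
  private module ℚ[y] = IntegralDomain ℚ[y]-domain

  y t : Carrier
  y = Series.C ℚ[y]-domain (Polynomial.X ℚ-domain)
  t = Series.X ℚ[y]-domain

  record Parameters (√ u v : Carrier) : Set where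
    field
      √-constant : coeff √ 0 ℚ[y].≈ ℚ[y].1#
      √-square   : √ ^ 2 ≈ (1# + t) ^ 2 - 4# * y * t
      u-def      : u IsQuotient (1# + t ^ 2 - 2# * y * t - (1# - t) * √) / (2# * (1# - y) * t)
      v-def      : v IsQuotient ((1# + t) ^ 2 - 2# * y * t - (1# + t) * √) / (2# * y * t)

{-# OPTIONS --safe #-}

-- Removing the root of the first tree of a forest turns m trees with n + 1 nodes into
-- m - 1, m or m + 1 trees with n nodes (m in two ways, for a left and for a right child).
-- Keeping track of tc and nlc, this linear recurrence is solved by ballot numbers times
-- the coefficients of (z + 1 + t)ⁿ, both of which obey Pascal-like rules; one tree gives
--   Tₙ₊₁(y,t) = γₙ(yt, 1 + t),  γₙ(s,p) = ∑ₖ Catₖ (n choose 2k) sᵏ⁺¹ pⁿ⁻²ᵏ.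
-- By Vandermonde's identity, also Nₙ₊₁(t) = γₙ(t, 1 + t).  As γₙ(l²s, lp) = lⁿ⁺² γₙ(s,p),
-- the substitutions only have to satisfy l²(YT) = t, l(1 + T) = 1 + t for the rational
-- functions, and w²v = yt, w(1 + v) = 1 + t for the power series.

module Submission where

open import Defs
open import Algebra.Bundles using (CommutativeRing; CommutativeSemiring; Semiring)
open import Algebra.Morphism.Structures using (IsRingHomomorphism)
open import Algebra.Solver.Ring.AlmostCommutativeRing using (fromCommutativeRing; _-Raw-AlmostCommutative⟶_)
open import Data.Fin.Base using (Fin; toℕ)
open import Data.Fin.Properties using (toℕ<n)
open import Data.Integer.Base using (_⊖_)
open import Data.List.Base using (List; []; _∷_; [_]; _++_; map; foldr; filter; length)
open import Data.List.Membership.Propositional using (_∈_)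
open import Data.List.Membership.Propositional.Properties using (∈-map⁺; ∈-map⁻; ∈-++⁺ˡ; ∈-++⁺ʳ; ∈-++⁻)
open import Data.List.Membership.Propositional.Properties.WithK using (unique∧set⇒bag)
open import Data.List.Properties using (map-∘)
open import Data.List.Relation.Binary.BagAndSetEquality using (∼bag⇒↭)
open import Data.List.Relation.Binary.Disjoint.Propositional using (Disjoint)
open import Data.List.Relation.Binary.Permutation.Propositional as Perm using (_↭_)
open import Data.List.Relation.Unary.All as ListAll using ()
open import Data.List.Relation.Unary.Any using (here; there)
open import Data.List.Relation.Unary.Unique.Propositional using (Unique)
open import Data.Maybe.Base using (Maybe; just; nothing)
open import Data.Nat.Base using (ℕ; zero; suc; _∸_; _≤_; _<_; z≤n; s≤s; NonZero)
open import Data.Nat.Combinatorics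
  using (_C_; nCk+nC[k+1]≡[n+1]C[k+1]; nCk≡nC[n∸k]; nCn≡1; k>n⇒nCk≡0; nCk≡n!/k![n-k]!; k![n∸k]!∣n!)
open import Data.Nat.DivMod using (m/n*n≡m; m*n/n≡m; m/n*n≤m; /-monoˡ-≤)
open import Data.Nat.Tactic.RingSolver using (solve; solve-∀)
open import Data.Product.Base using (_×_; _,_; proj₁; proj₂; ∃-syntax)
open import Data.Sum.Base using (inj₁; inj₂)
open import Function.Base using (_∘_)
open import Function.Bundles using (mk⇔)
open import Relation.Binary.PropositionalEquality as ≡ using (_≡_)
open import Relation.Nullary using (¬_; Dec; yes; no; contradiction)
open import Relation.Nullary.Decidable using (_×-dec_)
import Algebra.Properties.CommutativeSemigroup as CommutativeSemigroup
import Algebra.Properties.CommutativeSemiring.Exp as CommutativeSemiringExp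
import Algebra.Properties.Ring as RingProperties
import Algebra.Properties.Semiring.Exp as SemiringExp
import Algebra.Properties.Semiring.Mult as SemiringMult
import Algebra.Properties.Semiring.Sum as SemiringSum
import Algebra.Solver.Ring as RingSolver
import Algebra.Solver.Ring.NaturalCoefficients.Default as SemiringSolver
import Data.Integer.Base as ℤ
import Data.Integer.Properties as ℤ
import Data.List.Relation.Unary.Unique.Propositional.Properties as Unique
import Data.Nat.Base as ℕ
import Data.Nat.Properties as ℕ
import Data.Rational.Base as ℚ
import Data.Rational.Properties as ℚ
import Data.Rational.Unnormalised.Base as ℚᵘ
import Data.Rational.Unnormalised.Properties as ℚᵘ

-- Splitting a single tree at its root gives a quadratic recurrence with a convolution. Forests make
-- it linear at the price of the parameter m, so the closed form has to be proved for every m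
-- although only one tree is wanted in the end. The variable y is represented by the index k until
-- the coefficients are summed up.
--
-- The arguments of γ are best read as product and sum of two quantities: γₙ(ab, a + b) is symmetric
-- and homogeneous of degree n + 2 in a and b, and Nₙ₊₁(t) is its value at 1 and t. For Tₙ₊₁(y,t)
-- the two quantities are the roots w and wv of X² - (1 + t) X + yt, whence the square root, and the
-- ratio v of the roots as argument of N.
--
-- The other obstacle is that u and v are quotients by 2(1 - y)t and 2yt, which are not invertible
-- power series. Identities for given parameters are obtained by cancelling in an integral domain;
-- that such parameters exist at all is a separate matter, settled by a fixed-point construction.

private module ℕΣ = SemiringSum ℕ.+-*-semiring

-- Sums over initial segments

module RangeSum {c ℓ} (S : Semiring c ℓ) where
  open Semiring S hiding (zero)
  open SemiringSum S

  ∑-zero : ∀ (f : ℕ → Carrier) n → (∀ i → f i ≈ 0#) → ∑[ i < n ] f (toℕ i) ≈ 0#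
  ∑-zero f n f≈0 = trans (sum-cong-≋ {n} (λ i → f≈0 (toℕ i))) (sum-replicate-zero n)

  ∑-extend : ∀ (f : ℕ → Carrier) {m n} → m ≤ n → (∀ i → m ≤ i → f i ≈ 0#) →
             ∑[ i < n ] f (toℕ i) ≈ ∑[ i < m ] f (toℕ i)
  ∑-extend f {n = n} z≤n     f≈0 = ∑-zero f n (λ i → f≈0 i z≤n)
  ∑-extend f         (s≤s p) f≈0 = +-congˡ (∑-extend (λ i → f (suc i)) p (λ i q → f≈0 (suc i) (s≤s q)))

-- Binomial identities, from ballot numbers to Narayana numbers

module Binomials where
  open import Data.Nat.Base using (_+_; _*_; _!)
  open SemiringSum ℕ.+-*-semiring
  open RangeSum ℕ.+-*-semiring
  open ≡ using (refl; cong; cong₂)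
  open ≡.≡-Reasoning

  pascal : ∀ n k → suc n C suc k ≡ n C k + n C suc k
  pascal n k = ≡.sym (nCk+nC[k+1]≡[n+1]C[k+1] n k)

  nC0≡1 : ∀ n → n C 0 ≡ 1
  nC0≡1 n = ≡.trans (nCk≡nC[n∸k] {0} {n} z≤n) (nCn≡1 n)

  C-symmetric : ∀ x y → (x + y) C x ≡ (x + y) C y
  C-symmetric x y = ≡.trans (nCk≡nC[n∸k] (ℕ.m≤m+n x y)) (cong ((x + y) C_) (ℕ.m+n∸m≡n x y))

  -- Naming the lower index and its complement separately keeps truncated subtraction out of the
  -- factorial cancellations below.
  C-factorial : ∀ x y → ((x + y) C x) * (x ! * y !) ≡ (x + y) !
  C-factorial x y = begin
    ((x + y) C x) * (x ! * y !)                 ≡⟨ cong (λ z → ((x + y) C x) * (x ! * z !)) (ℕ.m+n∸m≡n x y) ⟨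
    ((x + y) C x) * (x ! * (x + y ∸ x) !)       ≡⟨ cong (_* (x ! * (x + y ∸ x) !)) (nCk≡n!/k![n-k]! x≤x+y) ⟩
    ((x + y) ! ℕ./ (x ! * (x + y ∸ x) !)) * (x ! * (x + y ∸ x) !)  ≡⟨ m/n*n≡m (k![n∸k]!∣n! x≤x+y) ⟩
    (x + y) !                                 ∎
    where
    x≤x+y = ℕ.m≤m+n x y
    instance _ = x ℕ.!* (x + y ∸ x) !≢0

  C-absorption : ∀ n k → suc k * (suc n C suc k) ≡ suc n * (n C k)
  C-absorption n k with k ℕ.≤? n
  ... | no k≰n = begin
    suc k * (suc n C suc k)   ≡⟨ cong (suc k *_) (k>n⇒nCk≡0 (s≤s (ℕ.≰⇒> k≰n))) ⟩
    suc k * 0                 ≡⟨ ℕ.*-zeroʳ (suc k) ⟩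
    0                         ≡⟨ ℕ.*-zeroʳ (suc n) ⟨
    suc n * 0                 ≡⟨ cong (suc n *_) (k>n⇒nCk≡0 (ℕ.≰⇒> k≰n)) ⟨
    suc n * (n C k)           ∎
  ... | yes k≤n with ℕ.m≤n⇒∃[o]m+o≡n k≤n
  ... | l , refl = ℕ.*-cancelʳ-≡ _ _ (k ! * l !) (begin
    suc k * (suc (k + l) C suc k) * (k ! * l !)   ≡⟨ rearrange (suc k) (suc (k + l) C suc k) (k !) (l !) ⟩
    (suc (k + l) C suc k) * (suc k ! * l !)         ≡⟨ C-factorial (suc k) l ⟩
    suc (k + l) * (k + l) !                       ≡⟨ cong (suc (k + l) *_) (C-factorial k l) ⟨
    suc (k + l) * (((k + l) C k) * (k ! * l !))     ≡⟨ ℕ.*-assoc (suc (k + l)) ((k + l) C k) (k ! * l !) ⟨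
    suc (k + l) * ((k + l) C k) * (k ! * l !)     ∎)
    where
    instance _ = k ℕ.!* l !≢0
    rearrange : ∀ a b c d → a * b * (c * d) ≡ b * (a * c * d)
    rearrange = solve-∀

  -- The number of ordered forests of m + 1 full binary trees with k internal nodes.
  ballot : ℕ → ℕ → ℕ
  ballot zero    m       = 1
  ballot (suc k) zero    = ballot k 1
  ballot (suc k) (suc m) = ballot (suc k) m + ballot k (2 + m)

  -- The reflection principle.
  ballot-binomial : ∀ k m → ballot (suc k) m + (2 + (k + k + m)) C k ≡ (2 + (k + k + m)) C suc k
  ballot-binomial zero    zero    = refl
  ballot-binomial zero    (suc m) = begin
    ballot 1 m + 1 + (3 + m) C 0          ≡⟨ cong (λ x → ballot 1 m + 1 + x) (nC0≡1 (3 + m)) ⟩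
    ballot 1 m + 1 + 1                    ≡⟨ cong (λ x → ballot 1 m + x + 1) (nC0≡1 (2 + m)) ⟨
    ballot 1 m + (2 + m) C 0 + 1          ≡⟨ cong (_+ 1) (ballot-binomial zero m) ⟩
    (2 + m) C 1 + 1                       ≡⟨ ℕ.+-comm ((2 + m) C 1) 1 ⟩
    1 + (2 + m) C 1                       ≡⟨ cong (_+ (2 + m) C 1) (nC0≡1 (2 + m)) ⟨
    (2 + m) C 0 + (2 + m) C 1             ≡⟨ pascal (2 + m) 0 ⟨
    (3 + m) C 1                           ∎
  ballot-binomial (suc k) zero    = begin
    ballot (suc k) 1 + suc M C suc k              ≡⟨ cong (ballot (suc k) 1 +_) (pascal M k) ⟩
    ballot (suc k) 1 + (M C k + M C suc k)        ≡⟨ ℕ.+-assoc (ballot (suc k) 1) (M C k) (M C suc k) ⟨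
    ballot (suc k) 1 + M C k + M C suc k          ≡⟨ cong (λ x → ballot (suc k) 1 + x C k + M C suc k) M≡ ⟩
    ballot (suc k) 1 + (2 + (k + k + 1)) C k + M C suc k
      ≡⟨ cong (_+ M C suc k) (ballot-binomial k 1) ⟩
    (2 + (k + k + 1)) C suc k + M C suc k         ≡⟨ cong (λ x → x C suc k + M C suc k) M≡ ⟨
    M C suc k + M C suc k                         ≡⟨ cong (λ x → M C suc k + x C suc k) M≡′ ⟩
    -- Row M = 2k + 3 is odd, so its two middle entries agree; this is where the boundary of the
    -- reflection enters.
    M C suc k + (suc k + suc (suc k)) C suc k     ≡⟨ cong ((M C suc k) +_) (C-symmetric (suc k) (suc (suc k))) ⟩
    M C suc k + (suc k + suc (suc k)) C suc (suc k) ≡⟨ cong (λ x → M C suc k + x C suc (suc k)) M≡′ ⟨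
    M C suc k + M C suc (suc k)                   ≡⟨ pascal M (suc k) ⟨
    suc M C suc (suc k)                           ∎
    where
    M = suc (suc (k + suc k + 0))
    M≡ : suc (suc (k + suc k + 0)) ≡ 2 + (k + k + 1)
    M≡ = solve (k ∷ [])
    M≡′ : suc (suc (k + suc k + 0)) ≡ suc k + suc (suc k)
    M≡′ = solve (k ∷ [])
  ballot-binomial (suc k) (suc m) = begin
    B₁ + B₂ + (2 + (suc k + suc k + suc m)) C suc k
      ≡⟨ cong (λ x → B₁ + B₂ + suc x C suc k) M≡ ⟩
    B₁ + B₂ + suc M C suc k                       ≡⟨ cong (B₁ + B₂ +_) (pascal M k) ⟩
    B₁ + B₂ + (M C k + M C suc k)                 ≡⟨ rearrange B₁ B₂ (M C k) (M C suc k) ⟩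
    (B₁ + M C suc k) + (B₂ + M C k)               ≡⟨ cong (λ x → B₁ + M C suc k + (B₂ + x C k)) M≡′ ⟩
    (B₁ + M C suc k) + (B₂ + M′ C k)              ≡⟨ cong₂ _+_ (ballot-binomial (suc k) m) (ballot-binomial k (2 + m)) ⟩
    M C suc (suc k) + M′ C suc k                  ≡⟨ cong (λ x → M C suc (suc k) + x C suc k) M≡′ ⟨
    M C suc (suc k) + M C suc k                   ≡⟨ ℕ.+-comm (M C suc (suc k)) (M C suc k) ⟩
    M C suc k + M C suc (suc k)                   ≡⟨ pascal M (suc k) ⟨
    suc M C suc (suc k)                           ≡⟨ cong (λ x → suc x C suc (suc k)) M≡ ⟨
    (2 + (suc k + suc k + suc m)) C suc (suc k)   ∎
    where
    B₁ = ballot (suc (suc k)) m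
    B₂ = ballot (suc k) (2 + m)
    M = 2 + (suc k + suc k + m)
    M′ = 2 + (k + k + (2 + m))
    M≡ : 1 + (suc k + suc k + suc m) ≡ 2 + (suc k + suc k + m)
    M≡ = solve (k ∷ m ∷ [])
    M≡′ : 2 + (suc k + suc k + m) ≡ 2 + (k + k + (2 + m))
    M≡′ = solve (k ∷ m ∷ [])
    rearrange : ∀ a b c d → a + b + (c + d) ≡ (a + d) + (b + c)
    rearrange = solve-∀

  -- At m = 0 reflection gives a difference of neighbouring binomials in row N = 2k + 2. Absorption
  -- turns (k + 1) (N choose k + 1) into (k + 2) (N choose k), so after multiplication by k + 2 the
  -- subtracted binomial cancels and a single (N choose k + 1) is left.
  catalan : ∀ k → suc k * ballot k 0 ≡ (2 * k) C k
  catalan zero    = refl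
  catalan (suc k) = ≡.trans (ℕ.+-cancelʳ-≡ (suc (suc k) * (N C k)) _ _ (begin
    suc (suc k) * ballot (suc k) 0 + suc (suc k) * (N C k)
      ≡⟨ ℕ.*-distribˡ-+ (suc (suc k)) (ballot (suc k) 0) (N C k) ⟨
    suc (suc k) * (ballot (suc k) 0 + N C k)     ≡⟨ cong (suc (suc k) *_) (ballot-binomial k 0) ⟩
    suc (suc k) * (N C suc k)                    ≡⟨⟩
    N C suc k + suc k * (N C suc k)              ≡⟨ cong ((N C suc k) +_) absorb ⟩
    N C suc k + suc (suc k) * (N C k)            ∎))
    (cong (_C suc k) N≡)
    where
    N = 2 + (k + k + 0)
    N≡ : 2 + (k + k + 0) ≡ 2 * suc k
    N≡ = solve (k ∷ [])
    M = 1 + (k + k + 0)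
    M≡ : 1 + (k + k + 0) ≡ k + suc k
    M≡ = solve (k ∷ [])
    N≡′ : 2 + (k + k + 0) ≡ k + suc (suc k)
    N≡′ = solve (k ∷ [])
    absorb : suc k * (N C suc k) ≡ suc (suc k) * (N C k)
    absorb = begin
      suc k * (N C suc k)             ≡⟨ C-absorption M k ⟩
      N * (M C k)                     ≡⟨ cong (λ x → N * (x C k)) M≡ ⟩
      N * ((k + suc k) C k)           ≡⟨ cong (N *_) (C-symmetric k (suc k)) ⟩
      N * ((k + suc k) C suc k)       ≡⟨ cong (λ x → N * (x C suc k)) M≡ ⟨
      N * (M C suc k)                 ≡⟨ C-absorption M (suc k) ⟨
      suc (suc k) * (N C suc (suc k)) ≡⟨ cong (λ x → suc (suc k) * (x C suc (suc k))) N≡′ ⟩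
      suc (suc k) * ((k + suc (suc k)) C suc (suc k)) ≡⟨ cong (suc (suc k) *_) (C-symmetric k (suc (suc k))) ⟨
      suc (suc k) * ((k + suc (suc k)) C k) ≡⟨ cong (λ x → suc (suc k) * (x C k)) N≡′ ⟨
      suc (suc k) * (N C k)           ∎

  ∑-pascal : ∀ (f : ℕ → ℕ) q → ∑[ k ≤ suc q ] (f (toℕ k) * (suc q C toℕ k)) ≡
             ∑[ k ≤ q ] (f (toℕ k) * (q C toℕ k)) + ∑[ k ≤ q ] (f (suc (toℕ k)) * (q C toℕ k))
  ∑-pascal f q = begin
    f 0 * (suc q C 0) + ∑[ k ≤ q ] (f (suc (toℕ k)) * (suc q C suc (toℕ k)))
      ≡⟨ cong₂ (λ x y → f 0 * x + y) (≡.trans (nC0≡1 (suc q)) (≡.sym (nC0≡1 q)))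
           (sum-cong-≗ {suc q} (λ k → ≡.trans (cong (f (suc (toℕ k)) *_) (pascal q (toℕ k)))
             (ℕ.*-distribˡ-+ (f (suc (toℕ k))) (q C toℕ k) (q C suc (toℕ k))))) ⟩
    f 0 * (q C 0) + ∑[ k ≤ q ] (f (suc (toℕ k)) * (q C toℕ k) + f (suc (toℕ k)) * (q C suc (toℕ k)))
      ≡⟨ cong (f 0 * (q C 0) +_) (∑-distrib-+ {suc q} (λ k → f (suc (toℕ k)) * (q C toℕ k)) (λ k → f (suc (toℕ k)) * (q C suc (toℕ k)))) ⟩
    f 0 * (q C 0) + (s + r)
      ≡⟨ x∙yz≈xz∙y (f 0 * (q C 0)) s r ⟩
    ∑[ k ≤ suc q ] (f (toℕ k) * (q C toℕ k)) + s
      -- The additional top term has the factor `q C suc q`, which is 0.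
      ≡⟨ cong (_+ s) (∑-extend (λ k → f k * (q C k)) (ℕ.n≤1+n (suc q))
           (λ i q<i → ≡.trans (cong (f i *_) (k>n⇒nCk≡0 q<i)) (ℕ.*-zeroʳ (f i)))) ⟩
    ∑[ k ≤ q ] (f (toℕ k) * (q C toℕ k)) + s  ∎
    where
    open CommutativeSemigroup ℕ.+-commutativeSemigroup using (x∙yz≈xz∙y)
    s = ∑[ k ≤ q ] (f (suc (toℕ k)) * (q C toℕ k))
    r = ∑[ k ≤ q ] (f (suc (toℕ k)) * (q C suc (toℕ k)))

  -- The usual convolution with q choose k read as q choose q - k: the lower indices move in
  -- parallel and no subtraction occurs. The induction on q needs r free, since Pascal's rule for
  -- the second factor shifts the first one by 1.
  vandermonde : ∀ p q r → ∑[ k ≤ q ] ((p C (toℕ k + r)) * (q C toℕ k)) ≡ (p + q) C (q + r)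
  vandermonde p zero    r = begin
    (p C r) * 1 + 0   ≡⟨ ℕ.+-identityʳ _ ⟩
    (p C r) * 1       ≡⟨ ℕ.*-identityʳ _ ⟩
    p C r           ≡⟨ cong (_C r) (ℕ.+-identityʳ p) ⟨
    (p + 0) C r     ∎
  vandermonde p (suc q) r = begin
    ∑[ k ≤ suc q ] ((p C (toℕ k + r)) * (suc q C toℕ k))
      ≡⟨ ∑-pascal (λ k → p C (k + r)) q ⟩
    ∑[ k ≤ q ] ((p C (toℕ k + r)) * (q C toℕ k)) + ∑[ k ≤ q ] ((p C (suc (toℕ k) + r)) * (q C toℕ k))
      ≡⟨ cong₂ _+_ (vandermonde p q r)
           (sum-cong-≗ {suc q} (λ k → cong (λ x → (p C x) * (q C toℕ k)) (≡.sym (ℕ.+-suc (toℕ k) r)))) ⟩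
    (p + q) C (q + r) + ∑[ k ≤ q ] ((p C (toℕ k + suc r)) * (q C toℕ k))
      ≡⟨ cong (((p + q) C (q + r)) +_) (vandermonde p q (suc r)) ⟩
    (p + q) C (q + r) + (p + q) C (q + suc r)
      ≡⟨ cong (λ x → (p + q) C (q + r) + (p + q) C x) (ℕ.+-suc q r) ⟩
    (p + q) C (q + r) + (p + q) C suc (q + r)
      ≡⟨ pascal (p + q) (q + r) ⟨
    suc (p + q) C suc (q + r)
      ≡⟨ cong (_C suc (q + r)) (ℕ.+-suc p q) ⟨
    (p + suc q) C suc (q + r) ∎

  -- The coefficient of tᵃ in tᵏ (1 + t)ᵐ.
  shiftedC : ℕ → ℕ → ℕ → ℕ
  shiftedC m a       zero    = m C a
  shiftedC m zero    (suc k) = 0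
  shiftedC m (suc a) (suc k) = shiftedC m a k

  shiftedC≡Cℤ : ∀ m a k → shiftedC m a k ≡ m Cℤ (a ⊖ k)
  shiftedC≡Cℤ m a       zero    = refl
  shiftedC≡Cℤ m zero    (suc k) = refl
  shiftedC≡Cℤ m (suc a) (suc k) = ≡.trans (shiftedC≡Cℤ m a k) (cong (m Cℤ_) (≡.sym (ℤ.[1+m]⊖[1+n]≡m⊖n a k)))

  shiftedC-< : ∀ m {a k} → a < k → shiftedC m a k ≡ 0
  shiftedC-< m {zero}  {suc k} _       = refl
  shiftedC-< m {suc a} {suc k} (s≤s p) = shiftedC-< m p

  shiftedC-+ : ∀ m k p → shiftedC m (k + p) k ≡ m C p
  shiftedC-+ m zero    p = refl
  shiftedC-+ m (suc k) p = shiftedC-+ m k p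

  -- Both sides are the multinomial coefficient (2k + p + q)! / (k! k! p! q!); the four blocks are
  -- first grouped as k, k against p, q or as k, p against k, q.
  trinomial : ∀ k p q → ((k + k + (p + q)) C (k + k)) * ((k + k) C k) * ((p + q) C p) ≡
              ((k + p + (k + q)) C (k + p)) * ((k + p) C k) * ((k + q) C k)
  trinomial k p q = ℕ.*-cancelʳ-≡ _ _ (k ! * k ! * (p ! * q !)) (begin
    (N C (k + k)) * ((k + k) C k) * ((p + q) C p) * (k ! * k ! * (p ! * q !))
      ≡⟨ rearrange₁ (N C (k + k)) ((k + k) C k) ((p + q) C p) (k !) (p !) (q !) ⟩
    (N C (k + k)) * (((k + k) C k) * (k ! * k !) * (((p + q) C p) * (p ! * q !)))
      ≡⟨ cong₂ (λ x y → (N C (k + k)) * (x * y)) (C-factorial k k) (C-factorial p q) ⟩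
    (N C (k + k)) * ((k + k) ! * (p + q) !)
      ≡⟨ C-factorial (k + k) (p + q) ⟩
    N !
      ≡⟨ cong _! N≡N′ ⟩
    N′ !
      ≡⟨ C-factorial (k + p) (k + q) ⟨
    (N′ C (k + p)) * ((k + p) ! * (k + q) !)
      ≡⟨ cong₂ (λ x y → (N′ C (k + p)) * (x * y)) (C-factorial k p) (C-factorial k q) ⟨
    (N′ C (k + p)) * (((k + p) C k) * (k ! * p !) * (((k + q) C k) * (k ! * q !)))
      ≡⟨ rearrange₂ (N′ C (k + p)) ((k + p) C k) ((k + q) C k) (k !) (p !) (q !) ⟩
    (N′ C (k + p)) * ((k + p) C k) * ((k + q) C k) * (k ! * k ! * (p ! * q !)) ∎)
    where
    N = k + k + (p + q)
    N′ = k + p + (k + q)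
    N≡N′ : k + k + (p + q) ≡ k + p + (k + q)
    N≡N′ = solve (k ∷ p ∷ q ∷ [])
    instance
      _ = k ℕ.!* k !≢0
      _ = p ℕ.!* q !≢0
      _ = ℕ.m*n≢0 (k ! * k !) (p ! * q !)
    rearrange₁ : ∀ a b c d e f → a * b * c * (d * d * (e * f)) ≡ a * (b * (d * d) * (c * (e * f)))
    rearrange₁ = solve-∀
    rearrange₂ : ∀ a b c d e f → a * (b * (d * e) * (c * (d * f))) ≡ a * b * c * (d * d * (e * f))
    rearrange₂ = solve-∀

  -- Turns a term of the γ expansion into a Vandermonde summand. With a = k + p and l = k + q this
  -- is `trinomial`, absorption trading the denominator k + 1 of the Catalan number for the factor a
  -- + 1. If k exceeds a or l, both sides vanish.
  ballot-term : ∀ a l k → suc a * (ballot k 0 * ((a + l) C (2 * k)) * shiftedC (a + l ∸ 2 * k) a k) ≡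
                ((a + l) C a) * ((suc a C (k + 1)) * (l C k))
  ballot-term a l k with k ℕ.≤? a
  ... | no k≰a = ≡.trans
    (cong (λ x → suc a * (ballot k 0 * ((a + l) C (2 * k)) * x)) (shiftedC-< _ (ℕ.≰⇒> k≰a)))
    (≡.trans (annihilate (suc a) (ballot k 0 * ((a + l) C (2 * k))) ((a + l) C a) (l C k)) (cong (λ x → ((a + l) C a) * (x * (l C k)))
      (≡.sym (k>n⇒nCk≡0 (ℕ.<-≤-trans (s≤s (ℕ.≰⇒> k≰a)) (ℕ.≤-reflexive (ℕ.+-comm 1 k)))))))
    where
    annihilate : ∀ a b c d → a * (b * 0) ≡ c * (0 * d)
    annihilate = solve-∀
  ... | yes k≤a with p , refl ← ℕ.m≤n⇒∃[o]m+o≡n k≤a | k ℕ.≤? l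
  ...   | yes k≤l with q , refl ← ℕ.m≤n⇒∃[o]m+o≡n k≤l = ℕ.*-cancelˡ-≡ _ _ (suc k) (begin
    suc k * (suc (k + p) * (ballot k 0 * (N′ C (2 * k)) * shiftedC (N′ ∸ 2 * k) (k + p) k))
      ≡⟨ rearrange₁ (suc k) (suc (k + p)) (ballot k 0) (N′ C (2 * k)) (shiftedC (N′ ∸ 2 * k) (k + p) k) ⟩
    suc (k + p) * ((N′ C (2 * k)) * (suc k * ballot k 0) * shiftedC (N′ ∸ 2 * k) (k + p) k)
      ≡⟨ cong₂ (λ x y → suc (k + p) * ((N′ C (2 * k)) * x * y)) (catalan k) (shiftedC-+ (N′ ∸ 2 * k) k p) ⟩
    suc (k + p) * ((N′ C (2 * k)) * ((2 * k) C k) * ((N′ ∸ 2 * k) C p))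
      ≡⟨ cong (λ x → suc (k + p) * ((N′ C x) * (x C k) * ((N′ ∸ x) C p))) 2k≡ ⟩
    suc (k + p) * ((N′ C (k + k)) * ((k + k) C k) * ((N′ ∸ (k + k)) C p))
      ≡⟨ cong (λ x → suc (k + p) * ((x C (k + k)) * ((k + k) C k) * ((x ∸ (k + k)) C p))) N≡N′ ⟨
    suc (k + p) * ((N C (k + k)) * ((k + k) C k) * ((N ∸ (k + k)) C p))
      ≡⟨ cong (λ x → suc (k + p) * ((N C (k + k)) * ((k + k) C k) * (x C p))) (ℕ.m+n∸m≡n (k + k) (p + q)) ⟩
    suc (k + p) * ((N C (k + k)) * ((k + k) C k) * ((p + q) C p))
      ≡⟨ cong (suc (k + p) *_) (trinomial k p q) ⟩
    suc (k + p) * ((N′ C (k + p)) * ((k + p) C k) * ((k + q) C k))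
      ≡⟨ rearrange₂ (suc (k + p)) (N′ C (k + p)) ((k + p) C k) ((k + q) C k) ⟩
    (N′ C (k + p)) * (suc (k + p) * ((k + p) C k) * ((k + q) C k))
      ≡⟨ cong (λ x → (N′ C (k + p)) * (x * ((k + q) C k))) (C-absorption (k + p) k) ⟨
    (N′ C (k + p)) * (suc k * (suc (k + p) C suc k) * ((k + q) C k))
      ≡⟨ rearrange₃ (N′ C (k + p)) (suc k) (suc (k + p) C suc k) ((k + q) C k) ⟩
    suc k * ((N′ C (k + p)) * ((suc (k + p) C suc k) * ((k + q) C k)))
      ≡⟨ cong (λ x → suc k * ((N′ C (k + p)) * ((suc (k + p) C x) * ((k + q) C k)))) (ℕ.+-comm 1 k) ⟩
    suc k * ((N′ C (k + p)) * ((suc (k + p) C (k + 1)) * ((k + q) C k))) ∎)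
    where
    N = k + k + (p + q)
    N′ = k + p + (k + q)
    N≡N′ : k + k + (p + q) ≡ k + p + (k + q)
    N≡N′ = solve (k ∷ p ∷ q ∷ [])
    2k≡ : 2 * k ≡ k + k
    2k≡ = solve (k ∷ [])
    rearrange₁ : ∀ a b c d e → a * (b * (c * d * e)) ≡ b * (d * (a * c) * e)
    rearrange₁ = solve-∀
    rearrange₂ : ∀ a b c d → a * (b * c * d) ≡ b * (a * c * d)
    rearrange₂ = solve-∀
    rearrange₃ : ∀ a b c d → a * (b * c * d) ≡ b * (a * (c * d))
    rearrange₃ = solve-∀
  ...   | no k≰l = ≡.trans (cong (suc (k + p) *_) vanishes) (≡.trans (annihilate (suc (k + p)) (N C (k + p)) (suc (k + p) C (k + 1)))
      (cong (λ x → ((k + p + l) C (k + p)) * ((suc (k + p) C (k + 1)) * x)) (≡.sym (k>n⇒nCk≡0 l<k))))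
    where
    l<k = ℕ.≰⇒> k≰l
    annihilate : ∀ a c d → a * 0 ≡ c * (d * 0)
    annihilate = solve-∀
    N = k + p + l
    vanishes : ballot k 0 * (N C (2 * k)) * shiftedC (N ∸ 2 * k) (k + p) k ≡ 0
    -- If 2k > N the truncated N - 2k says nothing about p, but N choose 2k is 0. Otherwise l < k
    -- gives N - 2k < p, and the shifted coefficient is 0.
    vanishes with 2 * k ℕ.≤? N
    ... | no 2k≰N = cong (_* shiftedC (N ∸ 2 * k) (k + p) k)
      (≡.trans (cong (ballot k 0 *_) (k>n⇒nCk≡0 (ℕ.≰⇒> 2k≰N))) (ℕ.*-zeroʳ (ballot k 0)))
    ... | yes 2k≤N = ≡.trans (cong (ballot k 0 * (N C (2 * k)) *_)
      (≡.trans (shiftedC-+ (N ∸ 2 * k) k p) (k>n⇒nCk≡0 N∸2k<p))) (ℕ.*-zeroʳ (ballot k 0 * (N C (2 * k))))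
      where
      k+p+k≡2k+p : k + p + k ≡ 2 * k + p
      k+p+k≡2k+p = solve (k ∷ p ∷ [])
      N<2k+p : N < 2 * k + p
      N<2k+p = ℕ.<-≤-trans (ℕ.+-monoʳ-< (k + p) l<k) (ℕ.≤-reflexive k+p+k≡2k+p)
      N∸2k<p : N ∸ 2 * k < p
      N∸2k<p = ℕ.+-cancelˡ-< (2 * k) _ _ (ℕ.≤-<-trans (ℕ.≤-reflexive (ℕ.m+[n∸m]≡n 2k≤N)) N<2k+p)

  -- The coefficient of t^(a + 1) in n Nₙ(t) for n = a + l + 1; the bound on K says that all k with
  -- N choose 2k nonzero are covered. The extra factor a + 1 needed by `ballot-term` reappears
  -- through absorption after summation, and is cancelled.
  narayana-sum : ∀ a l K → a + l < 2 * suc K →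
    suc (a + l) * ∑[ k ≤ K ] (ballot (toℕ k) 0 * ((a + l) C (2 * toℕ k)) * shiftedC (a + l ∸ 2 * toℕ k) a (toℕ k))
      ≡ (suc (a + l) C suc a) * (suc (a + l) C a)
  narayana-sum a l K N<2[1+K] = ℕ.*-cancelˡ-≡ _ _ (suc a) (begin
    suc a * (suc N * ∑[ k ≤ K ] f (toℕ k))      ≡⟨ x∙yz≈y∙xz (suc a) (suc N) (∑[ k ≤ K ] f (toℕ k)) ⟩
    suc N * (suc a * ∑[ k ≤ K ] f (toℕ k))      ≡⟨ cong (suc N *_) (*-distribˡ-sum {suc K} (suc a) (λ k → f (toℕ k))) ⟩
    suc N * ∑[ k ≤ K ] (suc a * f (toℕ k))      ≡⟨ cong (suc N *_) (sum-cong-≗ {suc K} (λ k → ballot-term a l (toℕ k))) ⟩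
    -- K and l are not comparable in general, so the range passes through K + l: beyond K the factor
    -- N choose 2k of the original terms is 0, beyond l the factor l choose k.
    suc N * ∑[ k ≤ K ] h (toℕ k)                ≡⟨ cong (suc N *_) (∑-extend h (ℕ.m≤m+n (suc K) l) h>K≡0) ⟨
    suc N * ∑[ k ≤ K + l ] h (toℕ k)            ≡⟨ cong (suc N *_) (∑-extend h (s≤s (ℕ.m≤n+m l K)) h>l≡0) ⟩
    suc N * ∑[ k ≤ l ] h (toℕ k)
      ≡⟨ cong (suc N *_) (*-distribˡ-sum {suc l} (N C a) (λ k → (suc a C (toℕ k + 1)) * (l C toℕ k))) ⟨
    suc N * ((N C a) * ∑[ k ≤ l ] ((suc a C (toℕ k + 1)) * (l C toℕ k)))
      ≡⟨ cong (λ x → suc N * ((N C a) * x)) (vandermonde (suc a) l 1) ⟩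
    suc N * ((N C a) * (suc N C (l + 1)))         ≡⟨ ℕ.*-assoc (suc N) (N C a) (suc N C (l + 1)) ⟨
    suc N * (N C a) * (suc N C (l + 1))         ≡⟨ cong₂ _*_ (≡.sym (C-absorption N a)) symmetric ⟩
    suc a * (suc N C suc a) * (suc N C a)       ≡⟨ ℕ.*-assoc (suc a) (suc N C suc a) (suc N C a) ⟩
    suc a * ((suc N C suc a) * (suc N C a))     ∎)
    where
    open CommutativeSemigroup ℕ.*-commutativeSemigroup using (x∙yz≈y∙xz)
    N = a + l
    f h : ℕ → ℕ
    f k = ballot k 0 * (N C (2 * k)) * shiftedC (N ∸ 2 * k) a k
    h k = (N C a) * ((suc a C (k + 1)) * (l C k))
    h>l≡0 : ∀ i → l < i → h i ≡ 0
    h>l≡0 i l<i = begin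
      (N C a) * ((suc a C (i + 1)) * (l C i))   ≡⟨ cong (λ x → (N C a) * ((suc a C (i + 1)) * x)) (k>n⇒nCk≡0 l<i) ⟩
      (N C a) * ((suc a C (i + 1)) * 0)         ≡⟨ cong ((N C a) *_) (ℕ.*-zeroʳ (suc a C (i + 1))) ⟩
      (N C a) * 0                             ≡⟨ ℕ.*-zeroʳ (N C a) ⟩
      0                                     ∎
    h>K≡0 : ∀ i → K < i → h i ≡ 0
    h>K≡0 i K<i = begin
      h i             ≡⟨ ballot-term a l i ⟨
      suc a * f i     ≡⟨ cong (λ x → suc a * (ballot i 0 * x * shiftedC (N ∸ 2 * i) a i))
                           (k>n⇒nCk≡0 (ℕ.<-≤-trans N<2[1+K] (ℕ.*-monoʳ-≤ 2 K<i))) ⟩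
      suc a * (ballot i 0 * 0 * shiftedC (N ∸ 2 * i) a i)
                      ≡⟨ cong (λ x → suc a * (x * shiftedC (N ∸ 2 * i) a i)) (ℕ.*-zeroʳ (ballot i 0)) ⟩
      suc a * 0       ≡⟨ ℕ.*-zeroʳ (suc a) ⟩
      0               ∎
    symmetric : suc N C (l + 1) ≡ suc N C a
    symmetric = begin
      suc N C (l + 1)         ≡⟨ cong₂ _C_ (ℕ.+-suc a l) (ℕ.+-comm 1 l) ⟨
      (a + suc l) C suc l     ≡⟨ C-symmetric a (suc l) ⟨
      (a + suc l) C a         ≡⟨ cong (_C a) (ℕ.+-suc a l) ⟩
      suc N C a               ∎

-- Forests and their enumeration by root removal

module Forests where
  open import Data.List.Relation.Unary.AllPairs using ([]; _∷_)
  open import Data.Vec.Base using (Vec; []; _∷_)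
  open import Data.Vec.Relation.Unary.All using (All; []; _∷_)
  open import Data.Nat.Base using (_+_)
  open ≡ using (refl; cong)

  Forest : ℕ → Set
  Forest = Vec BinaryTree

  -- `empty` encodes an absent child and must not count as a tree of a forest: otherwise
  -- `node empty empty` would arise from all four root constructions.
  data NonEmpty : BinaryTree → Set where
    node : ∀ {l r} → NonEmpty (node l r)

  total : ∀ {m} → (BinaryTree → ℕ) → Forest m → ℕ
  total f []      = 0
  total f (T ∷ F) = f T + total f F

  leaf : ∀ {m} → Forest m → Forest (suc m)
  leaf F = node empty empty ∷ F

  right left : ∀ {m} → Forest (suc m) → Forest (suc m)
  right (r ∷ F) = node empty r ∷ F
  left  (l ∷ F) = node l empty ∷ F

  both : ∀ {m} → Forest (suc (suc m)) → Forest (suc m)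
  both (l ∷ r ∷ F) = node l r ∷ F

  right-injective : ∀ {m} {F G : Forest (suc m)} → right F ≡ right G → F ≡ G
  right-injective {F = _ ∷ _} {_ ∷ _} refl = refl

  left-injective : ∀ {m} {F G : Forest (suc m)} → left F ≡ left G → F ≡ G
  left-injective {F = _ ∷ _} {_ ∷ _} refl = refl

  both-injective : ∀ {m} {F G : Forest (suc (suc m))} → both F ≡ both G → F ≡ G
  both-injective {F = _ ∷ _ ∷ _} {_ ∷ _ ∷ _} refl = refl

  -- The forests of m nonempty trees with n nodes in total, classified by
  -- what remains of the first tree when its root is removed.
  forests : ∀ m → ℕ → List (Forest m)
  forests zero    zero    = [ [] ]
  forests zero    (suc n) = []
  forests (suc m) zero    = []
  forests (suc m) (suc n) =
    map leaf (forests m n) ++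
    map right (forests (suc m) n) ++
    map left (forests (suc m) n) ++
    map both (forests (suc (suc m)) n)

  ∈-forests⁺ : ∀ {m} n (F : Forest m) → All NonEmpty F → total nodes F ≡ n → F ∈ forests m n
  ∈-forests⁺ zero    []      _           _  = here refl
  ∈-forests⁺ zero    (_ ∷ _) (node ∷ _)  ()
  ∈-forests⁺ {suc m} (suc n) (node empty empty ∷ F) (_ ∷ F⁺) eq =
    ∈-++⁺ˡ (∈-map⁺ leaf (∈-forests⁺ n F F⁺ (ℕ.suc-injective eq)))
  ∈-forests⁺ {suc m} (suc n) (node empty r@(node _ _) ∷ F) (_ ∷ F⁺) eq =
    ∈-++⁺ʳ (map leaf (forests m n)) (∈-++⁺ˡ
      (∈-map⁺ right (∈-forests⁺ n (r ∷ F) (node ∷ F⁺) (ℕ.suc-injective eq))))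
  ∈-forests⁺ {suc m} (suc n) (node l@(node _ _) empty ∷ F) (_ ∷ F⁺) eq =
    ∈-++⁺ʳ (map leaf (forests m n)) (∈-++⁺ʳ (map right (forests (suc m) n)) (∈-++⁺ˡ
      (∈-map⁺ left (∈-forests⁺ n (l ∷ F) (node ∷ F⁺)
        (≡.trans (cong (_+ total nodes F) (≡.sym (ℕ.+-identityʳ (nodes l)))) (ℕ.suc-injective eq))))))
  ∈-forests⁺ {suc m} (suc n) (node l@(node _ _) r@(node _ _) ∷ F) (_ ∷ F⁺) eq =
    ∈-++⁺ʳ (map leaf (forests m n)) (∈-++⁺ʳ (map right (forests (suc m) n))
      (∈-++⁺ʳ (map left (forests (suc m) n))
        (∈-map⁺ both (∈-forests⁺ n (l ∷ r ∷ F) (node ∷ node ∷ F⁺)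
          (≡.trans (≡.sym (ℕ.+-assoc (nodes l) (nodes r) (total nodes F))) (ℕ.suc-injective eq))))))

  -- Besides soundness this supplies the nonemptiness that refines a tree to a `node`, which
  -- separates the four blocks and lets `tc` and `nlc` reduce.
  ∈-forests⁻ : ∀ m n {F : Forest m} → F ∈ forests m n → All NonEmpty F × total nodes F ≡ n
  ∈-forests⁻ zero    zero    (here refl) = [] , refl
  ∈-forests⁻ (suc m) (suc n) F∈ with ∈-++⁻ (map leaf (forests m n)) F∈
  ... | inj₁ F∈₁ with ∈-map⁻ leaf F∈₁
  ...   | G , G∈ , refl with G⁺ , refl ← ∈-forests⁻ m n G∈ = node ∷ G⁺ , refl
  ∈-forests⁻ (suc m) (suc n) F∈ | inj₂ F∈₂ with ∈-++⁻ (map right (forests (suc m) n)) F∈₂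
  ... | inj₁ F∈₃ with ∈-map⁻ right F∈₃
  ...   | _ ∷ G , G∈ , refl with _ ∷ G⁺ , refl ← ∈-forests⁻ (suc m) n G∈ = node ∷ G⁺ , refl
  ∈-forests⁻ (suc m) (suc n) F∈ | inj₂ F∈₂ | inj₂ F∈₄ with ∈-++⁻ (map left (forests (suc m) n)) F∈₄
  ... | inj₁ F∈₅ with ∈-map⁻ left F∈₅
  ...   | l ∷ G , G∈ , refl with _ ∷ G⁺ , refl ← ∈-forests⁻ (suc m) n G∈ =
    node ∷ G⁺ , cong (λ x → suc (x + total nodes G)) (ℕ.+-identityʳ (nodes l))
  ∈-forests⁻ (suc m) (suc n) F∈ | inj₂ F∈₂ | inj₂ F∈₄ | inj₂ F∈₆ with ∈-map⁻ both F∈₆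
  ... | l ∷ r ∷ G , G∈ , refl with _ ∷ _ ∷ G⁺ , refl ← ∈-forests⁻ (suc (suc m)) n G∈ =
    node ∷ G⁺ , cong suc (ℕ.+-assoc (nodes l) (nodes r) (total nodes G))

  module _ (m n : ℕ) where
    private
      Ls = map leaf (forests m n)
      Rs = map right (forests (suc m) n)
      Ks = map left (forests (suc m) n)
      Bs = map both (forests (suc (suc m)) n)

    ∈-leaf : ∀ {F} → F ∈ Ls → ∃[ G ] F ≡ node empty empty ∷ G
    ∈-leaf F∈ with G , _ , refl ← ∈-map⁻ leaf F∈ = G , refl

    ∈-right : ∀ {F} → F ∈ Rs → ∃[ a ] ∃[ b ] ∃[ G ] F ≡ node empty (node a b) ∷ G
    ∈-right F∈ with _ ∷ _ , G∈ , refl ← ∈-map⁻ right F∈ with node ∷ _ , _ ← ∈-forests⁻ (suc m) n G∈ =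
      _ , _ , _ , refl

    ∈-left : ∀ {F} → F ∈ Ks → ∃[ a ] ∃[ b ] ∃[ G ] F ≡ node (node a b) empty ∷ G
    ∈-left F∈ with _ ∷ _ , G∈ , refl ← ∈-map⁻ left F∈ with node ∷ _ , _ ← ∈-forests⁻ (suc m) n G∈ =
      _ , _ , _ , refl

    ∈-both : ∀ {F} → F ∈ Bs → ∃[ a ] ∃[ b ] ∃[ c ] ∃[ d ] ∃[ G ] F ≡ node (node a b) (node c d) ∷ G
    ∈-both F∈ with _ ∷ _ ∷ _ , G∈ , refl ← ∈-map⁻ both F∈
              with node ∷ node ∷ _ , _ ← ∈-forests⁻ (suc (suc m)) n G∈ = _ , _ , _ , _ , _ , refl

    left-both-disjoint : Disjoint Ks Bs
    left-both-disjoint (F∈ , F∈′) with _ , _ , _ , refl ← ∈-left F∈ with () ← ∈-both F∈′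

    right-disjoint : Disjoint Rs (Ks ++ Bs)
    right-disjoint (F∈ , F∈′) with _ , _ , _ , refl ← ∈-right F∈ | ∈-++⁻ Ks F∈′
    ... | inj₁ F∈ₗ with () ← ∈-left F∈ₗ
    ... | inj₂ F∈ᵦ with () ← ∈-both F∈ᵦ

    leaf-disjoint : Disjoint Ls (Rs ++ Ks ++ Bs)
    leaf-disjoint (F∈ , F∈′) with _ , refl ← ∈-leaf F∈ | ∈-++⁻ Rs F∈′
    ... | inj₁ F∈ᵣ with () ← ∈-right F∈ᵣ
    ... | inj₂ F∈″ with ∈-++⁻ Ks F∈″
    ...   | inj₁ F∈ₗ with () ← ∈-left F∈ₗ
    ...   | inj₂ F∈ᵦ with () ← ∈-both F∈ᵦ

  forests-unique : ∀ m n → Unique (forests m n)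
  forests-unique zero    zero    = ListAll.[] ∷ []
  forests-unique zero    (suc n) = []
  forests-unique (suc m) zero    = []
  forests-unique (suc m) (suc n) =
    Unique.++⁺ (Unique.map⁺ (λ { refl → refl }) (forests-unique m n))
      (Unique.++⁺ (Unique.map⁺ right-injective (forests-unique (suc m) n))
        (Unique.++⁺ (Unique.map⁺ left-injective (forests-unique (suc m) n))
          (Unique.map⁺ both-injective (forests-unique (suc (suc m)) n))
          (left-both-disjoint m n))
        (right-disjoint m n))
      (leaf-disjoint m n)

  -- Both lists are free of duplicates and have the same members. Sums over the enumeration by
  -- height thereby become sums over the one that follows the recurrence.
  trees↭forests : ∀ n → map (_∷ []) (trees (suc n)) ↭ forests 1 (suc n)
  trees↭forests n = ∼bag⇒↭ (unique∧set⇒bag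
    (Unique.map⁺ (λ { refl → refl }) (trees-unique (suc n))) (forests-unique 1 (suc n))
    (mk⇔ to from))
    where
    to : ∀ {F} → F ∈ map (_∷ []) (trees (suc n)) → F ∈ forests 1 (suc n)
    to F∈ with ∈-map⁻ (_∷ []) F∈
    ... | empty , T∈ , refl with () ← ∈-trees⁻ {suc n} T∈
    ... | T@(node _ _) , T∈ , refl =
      ∈-forests⁺ (suc n) (T ∷ []) (node ∷ []) (≡.trans (ℕ.+-identityʳ (nodes T)) (∈-trees⁻ T∈))
    from : ∀ {F} → F ∈ forests 1 (suc n) → F ∈ map (_∷ []) (trees (suc n))
    from {T ∷ []} F∈ with _ , eq ← ∈-forests⁻ 1 (suc n) F∈ =
      ∈-map⁺ (_∷ []) (∈-trees⁺ T (≡.trans (≡.sym (ℕ.+-identityʳ (nodes T))) eq))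

  -- A nonempty tree has one leaf more than it has nodes with two children, and the two kinds are
  -- disjoint. This confines `tc` to the summation range of the explicit formula.
  tc-bound : ∀ l r → tc (node l r) + tc (node l r) < nodes (node l r)
  tc-bound empty          empty          = s≤s z≤n
  tc-bound empty          (node a b)     = ℕ.m<n⇒m<1+n (tc-bound a b)
  tc-bound (node a b)     empty          = ℕ.<-≤-trans (tc-bound a b) (ℕ.≤-trans (ℕ.m≤m+n _ 0) (ℕ.n≤1+n _))
  tc-bound l@(node a b)   r@(node c d)   = s≤s (≡.subst (_≤ nodes l + nodes r) eq
    (ℕ.+-mono-≤ (tc-bound a b) (tc-bound c d)))
    where
    rearrange : ∀ x y → suc (x + x) + suc (y + y) ≡ suc (x + y) + suc (x + y)
    rearrange = solve-∀
    eq = rearrange (tc l) (tc r)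

-- Sums over lists, natural coefficients and Kronecker deltas

module ListSum {c ℓ} (R : CommutativeSemiring c ℓ) where
  open CommutativeSemiring R
  open SemiringSum semiring
  open import Algebra.Properties.CommutativeSemigroup +-commutativeSemigroup using (x∙yz≈y∙xz)

  ⅀ : ∀ {A : Set} → List A → (A → Carrier) → Carrier
  ⅀ xs f = foldr _+_ 0# (map f xs)

  ⅀-cong : ∀ {A : Set} xs {f g : A → Carrier} → (∀ x → x ∈ xs → f x ≈ g x) → ⅀ xs f ≈ ⅀ xs g
  ⅀-cong []       f≈g = refl
  ⅀-cong (x ∷ xs) f≈g = +-cong (f≈g x (here ≡.refl)) (⅀-cong xs (λ y y∈ → f≈g y (there y∈)))

  ⅀-++ : ∀ {A : Set} xs ys (f : A → Carrier) → ⅀ (xs ++ ys) f ≈ ⅀ xs f + ⅀ ys f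
  ⅀-++ []       ys f = sym (+-identityˡ _)
  ⅀-++ (x ∷ xs) ys f = trans (+-congˡ (⅀-++ xs ys f)) (sym (+-assoc _ _ _))

  ⅀-map : ∀ {A B : Set} (h : A → B) xs (f : B → Carrier) → ⅀ (map h xs) f ≈ ⅀ xs (f ∘ h)
  ⅀-map h xs f = reflexive (≡.cong (foldr _+_ 0#) (≡.sym (map-∘ xs)))

  ⅀-distribˡ : ∀ {A : Set} a xs (f : A → Carrier) → a * ⅀ xs f ≈ ⅀ xs (λ x → a * f x)
  ⅀-distribˡ a []       f = zeroʳ a
  ⅀-distribˡ a (x ∷ xs) f = trans (distribˡ a _ _) (+-congˡ (⅀-distribˡ a xs f))

  ⅀-zero : ∀ {A : Set} (xs : List A) → ⅀ xs (λ _ → 0#) ≈ 0#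
  ⅀-zero []       = refl
  ⅀-zero (x ∷ xs) = trans (+-identityˡ _) (⅀-zero xs)

  ⅀-↭ : ∀ {A : Set} {xs ys : List A} (f : A → Carrier) → xs ↭ ys → ⅀ xs f ≈ ⅀ ys f
  ⅀-↭ f Perm.refl         = refl
  ⅀-↭ f (Perm.prep x p)   = +-congˡ (⅀-↭ f p)
  ⅀-↭ f (Perm.swap x y p) = trans (+-congˡ (+-congˡ (⅀-↭ f p))) (x∙yz≈y∙xz _ _ _)
  ⅀-↭ f (Perm.trans p q)  = trans (⅀-↭ f p) (⅀-↭ f q)

  ⅀-∑ : ∀ {A : Set} xs {n} (f : A → Fin n → Carrier) →
        ⅀ xs (λ x → ∑[ i < n ] f x i) ≈ ∑[ i < n ] ⅀ xs (λ x → f x i)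
  ⅀-∑ []       {n} f = sym (sum-replicate-zero n)
  ⅀-∑ (x ∷ xs) {n} f = trans (+-congˡ (⅀-∑ xs f)) (sym (∑-distrib-+ {n} (f x) _))

module Coefficients {c ℓ} (R : CommutativeSemiring c ℓ) where
  open CommutativeSemiring R hiding (zero)
  open SemiringSum semiring
  open SemiringMult semiring using (×-homo-+; ×1-homo-*) renaming (_×_ to _·_)

  open ListSum R

  ν : ℕ → Carrier
  ν b = b · 1#

  ν-+ : ∀ a b → ν (a ℕ.+ b) ≈ ν a + ν b
  ν-+ = ×-homo-+ 1#

  ν-* : ∀ a b → ν (a ℕ.* b) ≈ ν a * ν b
  ν-* = ×1-homo-*

  ν-∑ : ∀ (f : ℕ → ℕ) n → ν (ℕΣ.sum {n} (f ∘ toℕ)) ≈ ∑[ i < n ] ν (f (toℕ i))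
  ν-∑ f zero    = refl
  ν-∑ f (suc n) = trans (ν-+ (f 0) _) (+-congˡ (ν-∑ (f ∘ suc) n))

  -- The recursive form makes `δ (suc a) (suc k)` reduce to `δ a k`, which is how a root with two
  -- children lowers k.
  δ : ℕ → ℕ → Carrier
  δ zero    zero    = 1#
  δ zero    (suc k) = 0#
  δ (suc a) zero    = 0#
  δ (suc a) (suc k) = δ a k

  count : ∀ {A : Set} {P : A → Set} (P? : ∀ x → Dec (P x)) (f : A → Carrier) →
          (∀ x → P x → f x ≈ 1#) → (∀ x → ¬ P x → f x ≈ 0#) →
          ∀ xs → ν (length (filter P? xs)) ≈ ⅀ xs f
  count P? f f≈1 f≈0 []       = refl
  count P? f f≈1 f≈0 (x ∷ xs) with P? x
  ... | yes p = +-cong (sym (f≈1 x p)) (count P? f f≈1 f≈0 xs)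
  ... | no ¬p = trans (count P? f f≈1 f≈0 xs) (sym (trans (+-congʳ (f≈0 x ¬p)) (+-identityˡ _)))

  δ-refl : ∀ a → δ a a ≈ 1#
  δ-refl zero    = refl
  δ-refl (suc a) = δ-refl a

  δ-≢ : ∀ {a k} → ¬ a ≡ k → δ a k ≈ 0#
  δ-≢ {zero}  {zero}  a≢k = contradiction ≡.refl a≢k
  δ-≢ {zero}  {suc k} a≢k = refl
  δ-≢ {suc a} {zero}  a≢k = refl
  δ-≢ {suc a} {suc k} a≢k = δ-≢ (a≢k ∘ ≡.cong suc)

  ∑-δ : ∀ (f : ℕ → Carrier) {a n} → a < n → ∑[ k < n ] (f (toℕ k) * δ a (toℕ k)) ≈ f a
  ∑-δ f {zero}  {suc n} (s≤s _) = trans (+-cong (*-identityʳ (f 0))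
    (trans (sum-cong-≋ {n} (λ k → zeroʳ (f (suc (toℕ k))))) (sum-replicate-zero n))) (+-identityʳ (f 0))
  ∑-δ f {suc a} {suc n} (s≤s p) = trans (+-cong (zeroʳ (f 0)) (∑-δ (f ∘ suc) p)) (+-identityˡ _)

-- The linear recurrence for forests and its closed form

module ForestSum {c ℓ} (R : CommutativeSemiring c ℓ) (t : CommutativeSemiring.Carrier R) where
  open CommutativeSemiring R hiding (zero)
  open SemiringSum semiring
  open SemiringExp semiring using (_^_; ^-congʳ)
  open SemiringSolver R using (_:+_; _:*_; _:=_; con) renaming (solve to solveR)
  open ListSum R
  open Coefficients R
  open Forests
  open Binomials
  open import Relation.Binary.Reasoning.Setoid setoid

  -- The contribution of a forest to the coefficient of y^k, with y itself kept out of the ring.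
  weight : ∀ {m} → ℕ → Forest m → Carrier
  weight k F = δ (total tc F) k * t ^ total nlc F

  both-weight : ∀ {m} → ℕ → Forest (suc (suc m)) → Carrier
  both-weight zero    F = 0#
  both-weight (suc k) F = weight k F

  P : ℕ → ℕ → ℕ → Carrier
  P m n k = ⅀ (forests m n) (weight k)

  -- A removed root contributes t if it had no left child (`leaf`, `right`), 1 if it had only a left
  -- child, and a decrement of k if it had both.
  P-suc : ∀ m n k → P (suc m) (suc n) k ≈
    t * P m n k + (t * P (suc m) n k + (P (suc m) n k + ⅀ (forests (suc (suc m)) n) (both-weight k)))
  P-suc m n k = begin
    ⅀ (Ls ++ Rs ++ Ks ++ Bs) (weight k)
      ≈⟨ ⅀-++ Ls _ _ ⟩
    ⅀ Ls (weight k) + ⅀ (Rs ++ Ks ++ Bs) (weight k)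
      ≈⟨ +-congˡ (⅀-++ Rs _ _) ⟩
    ⅀ Ls (weight k) + (⅀ Rs (weight k) + ⅀ (Ks ++ Bs) (weight k))
      ≈⟨ +-congˡ (+-congˡ (⅀-++ Ks _ _)) ⟩
    ⅀ Ls (weight k) + (⅀ Rs (weight k) + (⅀ Ks (weight k) + ⅀ Bs (weight k)))
      ≈⟨ +-cong leafs (+-cong rights (+-cong lefts boths)) ⟩
    t * P m n k + (t * P (suc m) n k + (P (suc m) n k + ⅀ (forests (suc (suc m)) n) (both-weight k))) ∎
    where
    open import Data.Vec.Base using ([]; _∷_)
    open import Data.Vec.Relation.Unary.All using ([]; _∷_)
    Ls = map leaf (forests m n)
    Rs = map right (forests (suc m) n)
    Ks = map left (forests (suc m) n)
    Bs = map both (forests (suc (suc m)) n)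
    shift : ∀ x y → x * (t * y) ≈ t * (x * y)
    shift x y = solveR 3 (λ x y t → x :* (t :* y) := t :* (x :* y)) refl x y t
    leafs : ⅀ Ls (weight k) ≈ t * P m n k
    leafs = trans (⅀-map leaf (forests m n) (weight k))
      (trans (⅀-cong (forests m n) (λ F _ → shift _ _)) (sym (⅀-distribˡ t (forests m n) (weight k))))
    rights : ⅀ Rs (weight k) ≈ t * P (suc m) n k
    rights = trans (⅀-map right (forests (suc m) n) (weight k))
      (trans (⅀-cong (forests (suc m) n) (λ { (r ∷ F) _ → shift _ _ }))
        (sym (⅀-distribˡ t (forests (suc m) n) (weight k))))
    left-weight : ∀ F → F ∈ forests (suc m) n → weight k (left F) ≈ weight k F
    left-weight (l ∷ F) F∈ with node ∷ _ , _ ← ∈-forests⁻ (suc m) n F∈ =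
      *-congˡ (^-congʳ t (≡.cong (ℕ._+ total nlc F) (ℕ.+-identityʳ (nlc l))))
    lefts : ⅀ Ks (weight k) ≈ P (suc m) n k
    lefts = trans (⅀-map left (forests (suc m) n) (weight k)) (⅀-cong (forests (suc m) n) left-weight)
    weight-both : ∀ k F → F ∈ forests (suc (suc m)) n → weight k (both F) ≈ both-weight k F
    weight-both k (l ∷ r ∷ F) F∈ with node ∷ node ∷ _ , _ ← ∈-forests⁻ (suc (suc m)) n F∈ with k
    ... | zero   = zeroˡ _
    ... | suc k′ = *-cong
      (reflexive (≡.cong (λ x → δ x k′) (ℕ.+-assoc (tc l) (tc r) (total tc F))))
      (^-congʳ t (ℕ.+-assoc (nlc l) (nlc r) (total nlc F)))
    boths : ⅀ Bs (weight k) ≈ ⅀ (forests (suc (suc m)) n) (both-weight k)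
    boths = trans (⅀-map both (forests (suc (suc m)) n) (weight k)) (⅀-cong (forests (suc (suc m)) n) (weight-both k))

  -- The coefficient of zᵉ in (z + 1 + t)ⁿ.
  G : ℕ → ℕ → Carrier
  G n e = ν (n C e) * (1# + t) ^ (n ∸ e)

  G-zero : ∀ n → G (suc n) 0 ≈ (1# + t) * G n 0
  G-zero n = trans (*-congʳ (reflexive (≡.cong ν (≡.trans (nC0≡1 (suc n)) (≡.sym (nC0≡1 n))))))
    (solveR 3 (λ a b c → a :* (b :* c) := b :* (a :* c)) refl (ν (n C 0)) (1# + t) ((1# + t) ^ n))

  G-suc : ∀ n e → G (suc n) (suc e) ≈ G n e + (1# + t) * G n (suc e)
  G-suc n e = begin
    ν (suc n C suc e) * X ^ (n ∸ e)
      ≈⟨ *-congʳ (trans (reflexive (≡.cong ν (pascal n e))) (ν-+ (n C e) (n C suc e))) ⟩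
    (ν (n C e) + ν (n C suc e)) * X ^ (n ∸ e)
      ≈⟨ distribʳ _ _ _ ⟩
    G n e + ν (n C suc e) * X ^ (n ∸ e)
      ≈⟨ +-congˡ step ⟩
    G n e + X * G n (suc e) ∎
    where
    X = 1# + t
    step : ν (n C suc e) * X ^ (n ∸ e) ≈ X * (ν (n C suc e) * X ^ (n ∸ suc e))
    step with e ℕ.<? n
    ... | yes e<n = trans (*-congˡ (^-congʳ X (ℕ.+-∸-assoc 1 e<n)))
      (solveR 3 (λ a b c → a :* (b :* c) := b :* (a :* c)) refl (ν (n C suc e)) X (X ^ (n ∸ suc e)))
    -- Here both exponents truncate to 0 and do not differ by 1, but the binomial in front of them
    -- is 0.
    ... | no e≮n rewrite k>n⇒nCk≡0 {n} {suc e} (s≤s (ℕ.≮⇒≥ e≮n)) =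
      trans (zeroˡ _) (sym (trans (*-congˡ (zeroˡ _)) (zeroʳ X)))

  -- Induction on n by `P-suc`. The `right` and `left` terms combine to the factor 1 + t of `G-suc`.
  -- The `leaf` term, with m lowered by 1, and the `both` term, with m raised and k lowered by 1,
  -- lead to the same index of `G` and the same power of t, so their ballot numbers add up by the
  -- recurrence of `ballot`.
  P-closed : ∀ m n k → P (suc m) (suc n) k ≈ ν (ballot k m) * G n (k ℕ.+ k ℕ.+ m) * t ^ (k ℕ.+ suc m)
  P-closed zero zero zero = trans (P-suc 0 0 0)
    (solveR 1 (λ t → t :* (con 1 :* con 1 :+ con 0) :+ (t :* con 0 :+ (con 0 :+ con 0))
      := (con 1 :+ con 0) :* ((con 1 :+ con 0) :* con 1) :* (t :* con 1)) refl t)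
  P-closed zero zero (suc k) = trans (P-suc 0 0 (suc k))
    (solveR 4 (λ t a b c → t :* (con 0 :* con 1 :+ con 0) :+ (t :* con 0 :+ (con 0 :+ con 0))
      := a :* (con 0 :* b) :* c) refl t _ _ _)
  P-closed (suc m) zero zero = trans (P-suc (suc m) 0 0)
    (solveR 4 (λ t a b c → t :* con 0 :+ (t :* con 0 :+ (con 0 :+ con 0)) := a :* (con 0 :* b) :* c) refl t _ _ _)
  P-closed (suc m) zero (suc k) = trans (P-suc (suc m) 0 (suc k))
    (solveR 4 (λ t a b c → t :* con 0 :+ (t :* con 0 :+ (con 0 :+ con 0)) := a :* (con 0 :* b) :* c) refl t _ _ _)
  -- For a single tree the `leaf` term is `0#`: no tree remains to carry the other n + 1 nodes.
  P-closed zero (suc n) zero = begin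
    P 1 (suc (suc n)) 0
      ≈⟨ P-suc 0 (suc n) 0 ⟩
    t * 0# + (t * P 1 (suc n) 0 + (P 1 (suc n) 0 + ⅀ (forests 2 (suc n)) (both-weight 0)))
      ≈⟨ +-congˡ (+-cong (*-congˡ (P-closed 0 n 0)) (+-cong (P-closed 0 n 0) (⅀-zero (forests 2 (suc n))))) ⟩
    t * 0# + (t * (ν 1 * G n 0 * t ^ 1) + (ν 1 * G n 0 * t ^ 1 + 0#))
      ≈⟨ solveR 4 (λ t b g s → t :* con 0 :+ (t :* (b :* g :* s) :+ (b :* g :* s :+ con 0))
           := b :* ((con 1 :+ t) :* g) :* s) refl t (ν 1) (G n 0) (t ^ 1) ⟩
    ν 1 * ((1# + t) * G n 0) * t ^ 1
      ≈⟨ *-congʳ (*-congˡ (G-zero n)) ⟨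
    ν 1 * G (suc n) 0 * t ^ 1 ∎
  P-closed zero (suc n) (suc k) = begin
    P 1 (suc (suc n)) (suc k)
      ≈⟨ P-suc 0 (suc n) (suc k) ⟩
    t * 0# + (t * P 1 (suc n) (suc k) + (P 1 (suc n) (suc k) + P 2 (suc n) k))
      ≈⟨ +-congˡ (+-cong (*-congˡ (P-closed 0 n (suc k))) (+-cong (P-closed 0 n (suc k)) (P-closed 1 n k))) ⟩
    t * 0# + (t * (b * g₁ * s) + (b * g₁ * s + b * G n (k ℕ.+ k ℕ.+ 1) * t ^ (k ℕ.+ 2)))
      ≈⟨ +-congˡ (+-congˡ (+-congˡ (*-cong (*-congˡ (reflexive (≡.cong (G n) e≡))) (^-congʳ t (ℕ.+-suc k 1))))) ⟩
    t * 0# + (t * (b * g₁ * s) + (b * g₁ * s + b * g₀ * s))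
      ≈⟨ solveR 5 (λ t b g₀ g₁ s → t :* con 0 :+ (t :* (b :* g₁ :* s) :+ (b :* g₁ :* s :+ b :* g₀ :* s))
           := b :* (g₀ :+ (con 1 :+ t) :* g₁) :* s) refl t b g₀ g₁ s ⟩
    b * (g₀ + (1# + t) * g₁) * s
      ≈⟨ *-congʳ (*-congˡ (G-suc n e)) ⟨
    b * G (suc n) (suc e) * s ∎
    where
    e = k ℕ.+ suc k ℕ.+ 0
    e≡ : k ℕ.+ k ℕ.+ 1 ≡ k ℕ.+ suc k ℕ.+ 0
    e≡ = solve (k ∷ [])
    b = ν (ballot k 1)
    g₀ = G n e
    g₁ = G n (suc e)
    s = t ^ (suc k ℕ.+ 1)
  P-closed (suc m) (suc n) zero = begin
    P (suc (suc m)) (suc (suc n)) 0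
      ≈⟨ P-suc (suc m) (suc n) 0 ⟩
    t * P (suc m) (suc n) 0 + (t * P (suc (suc m)) (suc n) 0 + (P (suc (suc m)) (suc n) 0 +
      ⅀ (forests (suc (suc (suc m))) (suc n)) (both-weight 0)))
      ≈⟨ +-cong (*-congˡ (P-closed m n 0)) (+-cong (*-congˡ (P-closed (suc m) n 0))
           (+-cong (P-closed (suc m) n 0) (⅀-zero (forests (suc (suc (suc m))) (suc n))))) ⟩
    t * (ν 1 * g₀ * s) + (t * (ν 1 * g₁ * (t * s)) + (ν 1 * g₁ * (t * s) + 0#))
      ≈⟨ solveR 5 (λ t b g₀ g₁ s → t :* (b :* g₀ :* s) :+ (t :* (b :* g₁ :* (t :* s)) :+ (b :* g₁ :* (t :* s) :+ con 0))
           := b :* (g₀ :+ (con 1 :+ t) :* g₁) :* (t :* s)) refl t (ν 1) g₀ g₁ s ⟩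
    ν 1 * (g₀ + (1# + t) * g₁) * (t * s)
      ≈⟨ *-congʳ (*-congˡ (G-suc n m)) ⟨
    ν 1 * G (suc n) (suc m) * (t * s) ∎
    where
    g₀ = G n m
    g₁ = G n (suc m)
    s = t ^ suc m
  P-closed (suc m) (suc n) (suc k) = begin
    P (suc (suc m)) (suc (suc n)) (suc k)
      ≈⟨ P-suc (suc m) (suc n) (suc k) ⟩
    t * P (suc m) (suc n) (suc k) + (t * P (suc (suc m)) (suc n) (suc k) +
      (P (suc (suc m)) (suc n) (suc k) + P (suc (suc (suc m))) (suc n) k))
      ≈⟨ +-cong (*-congˡ (P-closed m n (suc k))) (+-cong (*-congˡ (P-closed (suc m) n (suc k)))
           (+-cong (P-closed (suc m) n (suc k)) (P-closed (suc (suc m)) n k))) ⟩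
    t * (b₁ * G n (suc k ℕ.+ suc k ℕ.+ m) * t ^ (suc k ℕ.+ suc m)) + (t * (ν (b₁′ ℕ.+ b₂′) * g₁ * s) +
      (ν (b₁′ ℕ.+ b₂′) * g₁ * s + b₂ * G n (k ℕ.+ k ℕ.+ (2 ℕ.+ m)) * t ^ (k ℕ.+ suc (suc (suc m)))))
      ≈⟨ +-cong (trans (*-congˡ (*-congʳ (*-congˡ (reflexive (≡.cong (G n) e≡₁))))) shift)
           (+-cong (*-congˡ (*-congʳ (*-congʳ b≈)))
             (+-cong (*-congʳ (*-congʳ b≈))
               (*-cong (*-congˡ (reflexive (≡.cong (G n) e≡₂))) (^-congʳ t (ℕ.+-suc k (suc (suc m))))))) ⟩
    b₁ * g₀ * s + (t * ((b₁ + b₂) * g₁ * s) + ((b₁ + b₂) * g₁ * s + b₂ * g₀ * s))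
      ≈⟨ solveR 6 (λ t b₁ b₂ g₀ g₁ s →
           b₁ :* g₀ :* s :+ (t :* ((b₁ :+ b₂) :* g₁ :* s) :+ ((b₁ :+ b₂) :* g₁ :* s :+ b₂ :* g₀ :* s))
           := (b₁ :+ b₂) :* (g₀ :+ (con 1 :+ t) :* g₁) :* s) refl t b₁ b₂ g₀ g₁ s ⟩
    (b₁ + b₂) * (g₀ + (1# + t) * g₁) * s
      ≈⟨ *-congʳ (*-cong b≈ (G-suc n e)) ⟨
    ν (b₁′ ℕ.+ b₂′) * G (suc n) (suc e) * s ∎
    where
    e = k ℕ.+ suc k ℕ.+ suc m
    e≡₁ : suc k ℕ.+ suc k ℕ.+ m ≡ k ℕ.+ suc k ℕ.+ suc m
    e≡₁ = solve (k ∷ m ∷ [])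
    e≡₂ : k ℕ.+ k ℕ.+ (2 ℕ.+ m) ≡ k ℕ.+ suc k ℕ.+ suc m
    e≡₂ = solve (k ∷ m ∷ [])
    b₁′ = ballot (suc k) m
    b₂′ = ballot k (2 ℕ.+ m)
    b₁ = ν b₁′
    b₂ = ν b₂′
    b≈ : ν (b₁′ ℕ.+ b₂′) ≈ b₁ + b₂
    b≈ = ν-+ b₁′ b₂′
    g₀ = G n e
    g₁ = G n (suc e)
    s = t ^ (suc k ℕ.+ suc (suc m))
    shift : t * (b₁ * g₀ * t ^ (suc k ℕ.+ suc m)) ≈ b₁ * g₀ * s
    shift = trans (solveR 4 (λ t b g s → t :* (b :* g :* s) := b :* g :* (t :* s)) refl t b₁ g₀ (t ^ (suc k ℕ.+ suc m)))
      (*-congˡ (^-congʳ t (≡.sym (ℕ.+-suc (suc k) (suc m)))))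

  trees-sum : ∀ n k → ⅀ (trees (suc n)) (λ T → δ (tc T) k * t ^ nlc T) ≈ ν (ballot k 0) * G n (2 ℕ.* k) * t ^ (k ℕ.+ 1)
  trees-sum n k = begin
    ⅀ (trees (suc n)) (λ T → δ (tc T) k * t ^ nlc T)
      ≈⟨ ⅀-cong (trees (suc n)) (λ T _ → *-cong (reflexive (≡.cong (λ x → δ x k) (≡.sym (ℕ.+-identityʳ (tc T)))))
           (^-congʳ t (≡.sym (ℕ.+-identityʳ (nlc T))))) ⟩
    ⅀ (trees (suc n)) (weight k ∘ (_∷ []))
      ≈⟨ ⅀-map (_∷ []) (trees (suc n)) (weight k) ⟨
    ⅀ (map (_∷ []) (trees (suc n))) (weight k)
      ≈⟨ ⅀-↭ (weight k) (trees↭forests n) ⟩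
    P 1 (suc n) k
      ≈⟨ P-closed 0 n k ⟩
    ν (ballot k 0) * G n (k ℕ.+ k ℕ.+ 0) * t ^ (k ℕ.+ 1)
      ≈⟨ *-congʳ (*-congˡ (reflexive (≡.cong (G n) (ℕ.+-assoc k k 0)))) ⟩
    ν (ballot k 0) * G n (2 ℕ.* k) * t ^ (k ℕ.+ 1) ∎
    where open import Data.Vec.Base using ([]; _∷_)

  shifted-power : ∀ m k L → k ℕ.+ m < L → t ^ k * (1# + t) ^ m ≈ ∑[ a < L ] (ν (shiftedC m (toℕ a) k) * t ^ toℕ a)
  shifted-power m (suc k) (suc L) (s≤s k+m<L) = begin
    t * t ^ k * (1# + t) ^ m
      ≈⟨ *-assoc _ _ _ ⟩
    t * (t ^ k * (1# + t) ^ m)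
      ≈⟨ *-congˡ (shifted-power m k L k+m<L) ⟩
    t * ∑[ a < L ] (ν (shiftedC m (toℕ a) k) * t ^ toℕ a)
      ≈⟨ *-distribˡ-sum {L} t _ ⟩
    ∑[ a < L ] (t * (ν (shiftedC m (toℕ a) k) * t ^ toℕ a))
      ≈⟨ sum-cong-≋ {L} (λ a → x∙yz≈y∙xz t _ _) ⟩
    ∑[ a < L ] (ν (shiftedC m (toℕ a) k) * (t * t ^ toℕ a))
      ≈⟨ trans (+-congʳ (zeroˡ _)) (+-identityˡ _) ⟨
    0# * 1# + ∑[ a < L ] (ν (shiftedC m (toℕ a) k) * (t * t ^ toℕ a)) ∎
    where open CommutativeSemigroup *-commutativeSemigroup using (x∙yz≈y∙xz)
  shifted-power zero zero (suc L) _ = begin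
    1# * 1#
      ≈⟨ solveR 0 (con 1 :* con 1 := (con 1 :+ con 0) :* con 1 :+ con 0) refl ⟩
    (1# + 0#) * 1# + 0#
      ≈⟨ +-congˡ (trans (sum-cong-≋ {L} (λ a → zeroˡ _)) (sum-replicate-zero L)) ⟨
    (1# + 0#) * 1# + ∑[ a < L ] (0# * (t * t ^ toℕ a)) ∎
  shifted-power (suc m) zero (suc L) (s≤s m<L) = begin
    1# * (X * X ^ m)
      ≈⟨ solveR 2 (λ t x → con 1 :* ((con 1 :+ t) :* x) := con 1 :* x :+ t :* (con 1 :* x)) refl t (X ^ m) ⟩
    1# * X ^ m + t * (1# * X ^ m)
      ≈⟨ +-cong (shifted-power m 0 (suc L) (ℕ.m<n⇒m<1+n m<L)) (*-congˡ (shifted-power m 0 L m<L)) ⟩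
    ∑[ a < suc L ] (ν (m C toℕ a) * t ^ toℕ a) + t * ∑[ a < L ] (ν (m C toℕ a) * t ^ toℕ a)
      ≈⟨ trans (+-congˡ (*-distribˡ-sum {L} t _)) (+-assoc _ _ _) ⟩
    ν (m C 0) * 1# + (∑[ a < L ] (ν (m C suc (toℕ a)) * (t * t ^ toℕ a)) + ∑[ a < L ] (t * (ν (m C toℕ a) * t ^ toℕ a)))
      ≈⟨ +-cong (*-congʳ (reflexive (≡.cong ν (≡.trans (nC0≡1 m) (≡.sym (nC0≡1 (suc m)))))))
           (trans (sym (∑-distrib-+ {L} _ _)) (sum-cong-≋ {L} (λ a → sym (step (toℕ a))))) ⟩
    ν (suc m C 0) * 1# + ∑[ a < L ] (ν (suc m C suc (toℕ a)) * (t * t ^ toℕ a)) ∎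
    where
    X = 1# + t
    step : ∀ a → ν (suc m C suc a) * (t * t ^ a) ≈ ν (m C suc a) * (t * t ^ a) + t * (ν (m C a) * t ^ a)
    step a = trans (*-congʳ (trans (reflexive (≡.cong ν (pascal m a))) (ν-+ (m C a) (m C suc a))))
      (solveR 4 (λ x y t s → (x :+ y) :* (t :* s) := y :* (t :* s) :+ t :* (x :* s)) refl
        (ν (m C a)) (ν (m C suc a)) t (t ^ a))

open import Data.Integer.Base using (+_)

-- Halving, and exact division in ℚ

module Halves where
  2*-≤ : ∀ {k n} → k < suc (n ℕ./ 2) → 2 ℕ.* k ≤ n
  2*-≤ {k} {n} (s≤s k≤n/2) = ℕ.≤-trans (ℕ.≤-reflexive (ℕ.*-comm 2 k)) (ℕ.≤-trans (ℕ.*-monoˡ-≤ 2 k≤n/2) (m/n*n≤m n 2))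

  ≤-/2 : ∀ {k n} → 2 ℕ.* k ≤ n → k ≤ n ℕ./ 2
  ≤-/2 {k} {n} 2k≤n = ≡.subst (_≤ n ℕ./ 2) (m*n/n≡m k 2)
    (/-monoˡ-≤ 2 (ℕ.≤-trans (ℕ.≤-reflexive (ℕ.*-comm k 2)) 2k≤n))

  <-2*[1+n/2] : ∀ n → n < 2 ℕ.* suc (n ℕ./ 2)
  <-2*[1+n/2] n = ℕ.≰⇒> λ le → ℕ.n≮n (n ℕ./ 2) (≤-/2 {suc (n ℕ./ 2)} le)

module ℚ-Fractions where
  open import Relation.Binary.Reasoning.Setoid ℚᵘ.≃-setoid
  open import Data.Rational.Base using (toℚᵘ)

  toℚᵘ-/ : ∀ m d → toℚᵘ (+ m ℚ./ suc d) ℚᵘ.≃ ℚᵘ.mkℚᵘ (+ m) d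
  toℚᵘ-/ m d = ℚ.toℚᵘ-fromℚᵘ (ℚᵘ.mkℚᵘ (+ m) d)

  -- The denominators k + 1 and n of the formulas divide exactly. Comparing unnormalised fractions
  -- avoids any computation of a gcd.
  exact-quotient : ∀ {k c m} → suc k ℕ.* c ≡ m → + m ℚ./ suc k ≡ + c ℚ./ 1
  exact-quotient {k} {c} ≡.refl = ℚ.fromℚᵘ-cong {ℚᵘ.mkℚᵘ (+ (suc k ℕ.* c)) k} {ℚᵘ.mkℚᵘ (+ c) 0}
    (ℚᵘ.*≡* (≡.trans (ℤ.*-identityʳ _) (≡.trans (ℤ.pos-* (suc k) c) (ℤ.*-comm (+ suc k) (+ c)))))

  exact-product : ∀ {k c m} → suc k ℕ.* c ≡ m → (+ 1 ℚ./ suc k) ℚ.* (+ m ℚ./ 1) ≡ + c ℚ./ 1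
  exact-product {k} {c} {m} eq = ≡.trans (ℚ.toℚᵘ-injective (begin
    toℚᵘ ((+ 1 ℚ./ suc k) ℚ.* (+ m ℚ./ 1))          ≈⟨ ℚ.toℚᵘ-homo-* (+ 1 ℚ./ suc k) (+ m ℚ./ 1) ⟩
    toℚᵘ (+ 1 ℚ./ suc k) ℚᵘ.* toℚᵘ (+ m ℚ./ 1)      ≈⟨ ℚᵘ.*-cong (toℚᵘ-/ 1 k) (toℚᵘ-/ m 0) ⟩
    ℚᵘ.mkℚᵘ (+ 1) k ℚᵘ.* ℚᵘ.mkℚᵘ (+ m) 0            ≈⟨ ℚᵘ.*≡* (≡.cong₂ ℤ._*_ (ℤ.*-identityˡ (+ m))
                                                          (≡.cong +_ (≡.sym (ℕ.*-identityʳ (suc k))))) ⟩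
    ℚᵘ.mkℚᵘ (+ m) k                                 ≈⟨ toℚᵘ-/ m k ⟨
    toℚᵘ (+ m ℚ./ suc k)                            ∎)) (exact-quotient eq)

  /1-suc : ∀ b → + suc b ℚ./ 1 ≡ ℚ.1ℚ ℚ.+ (+ b ℚ./ 1)
  /1-suc b = ℚ.toℚᵘ-injective (begin
    toℚᵘ (+ suc b ℚ./ 1)                    ≈⟨ toℚᵘ-/ (suc b) 0 ⟩
    ℚᵘ.mkℚᵘ (+ suc b) 0                     ≈⟨ ℚᵘ.*≡* (≡.cong (λ x → (+ 1 ℤ.+ x) ℤ.* + 1) (≡.sym (ℤ.*-identityʳ (+ b)))) ⟩
    ℚᵘ.1ℚᵘ ℚᵘ.+ ℚᵘ.mkℚᵘ (+ b) 0             ≈⟨ ℚᵘ.+-cong (ℚᵘ.≃-refl {ℚᵘ.1ℚᵘ}) (toℚᵘ-/ b 0) ⟨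
    toℚᵘ ℚ.1ℚ ℚᵘ.+ toℚᵘ (+ b ℚ./ 1)         ≈⟨ ℚ.toℚᵘ-homo-+ ℚ.1ℚ (+ b ℚ./ 1) ⟨
    toℚᵘ (ℚ.1ℚ ℚ.+ (+ b ℚ./ 1))             ∎)

-- Tree and Narayana polynomials as values of γ

module Evaluation (A : ℚ-Algebra) where
  open ℚ-Algebra A hiding (zero)
  open SemiringSum semiring using (sum-cong-≋; *-distribˡ-sum; *-distribʳ-sum; ∑-comm)
  open SemiringExp semiring using (^-congʳ; ^-congˡ; ^-homo-*)
  open CommutativeSemiringExp commutativeSemiring using (^-distrib-*)
  open SemiringSolver commutativeSemiring using (_:*_; _:=_) renaming (solve to solveR)
  open ListSum commutativeSemiring
  open Coefficients commutativeSemiring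
  open ForestSum commutativeSemiring using (trees-sum; shifted-power)
  open Binomials
  open Halves
  open ℚ-Fractions
  open import Relation.Binary.Reasoning.Setoid setoid
  private module ι = IsRingHomomorphism ι-homo

  ν≈ι : ∀ b → ν b ≈ ι (+ b ℚ./ 1)
  ν≈ι zero    = sym ι.0#-homo
  ν≈ι (suc b) = begin
    1# + ν b                          ≈⟨ +-cong (sym ι.1#-homo) (ν≈ι b) ⟩
    ι ℚ.1ℚ + ι (+ b ℚ./ 1)            ≈⟨ ι.+-homo ℚ.1ℚ (+ b ℚ./ 1) ⟨
    ι (ℚ.1ℚ ℚ.+ (+ b ℚ./ 1))          ≡⟨ ≡.cong ι (/1-suc b) ⟨
    ι (+ suc b ℚ./ 1)                 ∎

  -- The number of Motzkin paths of length n with k up steps, known as the γ-coefficients of the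
  -- Narayana polynomial of degree n + 1.
  γ-coefficient : ℕ → ℕ → ℕ
  γ-coefficient n k = ballot k 0 ℕ.* (n C (2 ℕ.* k))

  γ : ℕ → Carrier → Carrier → Carrier
  γ n s p = ∑[ k ≤ n ℕ./ 2 ] (ν (γ-coefficient n (toℕ k)) * (s ^ suc (toℕ k) * p ^ (n ∸ 2 ℕ.* toℕ k)))

  γ-cong : ∀ n {s s′ p p′} → s ≈ s′ → p ≈ p′ → γ n s p ≈ γ n s′ p′
  γ-cong n s≈ p≈ = sum-cong-≋ {suc (n ℕ./ 2)}
    (λ k → *-congˡ {ν (γ-coefficient n (toℕ k))} (*-cong (^-congˡ (suc (toℕ k)) s≈) (^-congˡ (n ∸ 2 ℕ.* toℕ k) p≈)))

  -- Every term has weight 2(k + 1) + (n - 2k) = n + 2; the subtraction is genuine because the sum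
  -- stops at n / 2.
  γ-homogeneous : ∀ n l s p → γ n (l * l * s) (l * p) ≈ l ^ (suc n ℕ.+ 1) * γ n s p
  γ-homogeneous n l s p = begin
    γ n (l * l * s) (l * p)
      ≈⟨ sum-cong-≋ {suc (n ℕ./ 2)} (λ k → trans (*-congˡ (term (toℕ k) (2*-≤ (toℕ<n k))))
           (x∙yz≈y∙xz (ν (γ-coefficient n (toℕ k))) _ _)) ⟩
    ∑[ k ≤ n ℕ./ 2 ] (l ^ (suc n ℕ.+ 1) * (ν (γ-coefficient n (toℕ k)) * (s ^ suc (toℕ k) * p ^ (n ∸ 2 ℕ.* toℕ k))))
      ≈⟨ *-distribˡ-sum {suc (n ℕ./ 2)} (l ^ (suc n ℕ.+ 1))
           (λ k → ν (γ-coefficient n (toℕ k)) * (s ^ suc (toℕ k) * p ^ (n ∸ 2 ℕ.* toℕ k))) ⟨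
    l ^ (suc n ℕ.+ 1) * γ n s p ∎
    where
    open CommutativeSemigroup *-commutativeSemigroup using (x∙yz≈y∙xz)
    term : ∀ k → 2 ℕ.* k ≤ n → (l * l * s) ^ suc k * (l * p) ^ (n ∸ 2 ℕ.* k) ≈
           l ^ (suc n ℕ.+ 1) * (s ^ suc k * p ^ (n ∸ 2 ℕ.* k))
    term k 2k≤n = begin
      (l * l * s) ^ suc k * (l * p) ^ e
        ≈⟨ *-cong (trans (^-distrib-* (l * l) s (suc k)) (*-congʳ (^-distrib-* l l (suc k)))) (^-distrib-* l p e) ⟩
      l ^ suc k * l ^ suc k * s ^ suc k * (l ^ e * p ^ e)
        ≈⟨ solveR 4 (λ a b c d → a :* a :* b :* (c :* d) := a :* a :* c :* (b :* d)) refl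
             (l ^ suc k) (s ^ suc k) (l ^ e) (p ^ e) ⟩
      l ^ suc k * l ^ suc k * l ^ e * (s ^ suc k * p ^ e)
        ≈⟨ *-congʳ (trans (*-congʳ (sym (^-homo-* l (suc k) (suc k)))) (sym (^-homo-* l (suc k ℕ.+ suc k) e))) ⟩
      l ^ (suc k ℕ.+ suc k ℕ.+ e) * (s ^ suc k * p ^ e)
        ≈⟨ *-congʳ (^-congʳ l exponent) ⟩
      l ^ (suc n ℕ.+ 1) * (s ^ suc k * p ^ e) ∎
      where
      e = n ∸ 2 ℕ.* k
      rearrange : ∀ k e → suc k ℕ.+ suc k ℕ.+ e ≡ 2 ℕ.+ (2 ℕ.* k ℕ.+ e)
      rearrange = solve-∀
      exponent : suc k ℕ.+ suc k ℕ.+ e ≡ suc n ℕ.+ 1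
      exponent = ≡.trans (rearrange k e) (≡.trans (≡.cong (2 ℕ.+_) (ℕ.m+[n∸m]≡n 2k≤n)) (ℕ.+-comm 1 (suc n)))

  -- Writing y^(tc T + 1) as a sum over k against `δ (tc T) k` sorts the trees by `tc`; by
  -- `tc-bound` the value k = tc T lies in the range.
  tree-polynomial : ∀ n y t → T⟨tc,nlc⟩ A (suc n) y t ≈
    ∑[ k ≤ n ℕ./ 2 ] (ν (γ-coefficient n (toℕ k)) * y ^ (toℕ k ℕ.+ 1) * t ^ (toℕ k ℕ.+ 1) * (1# + t) ^ (n ∸ 2 ℕ.* toℕ k))
  tree-polynomial n y t = begin
    ⅀ (trees (suc n)) (λ T → y ^ (tc T ℕ.+ 1) * t ^ nlc T)
      ≈⟨ ⅀-cong (trees (suc n)) (λ T T∈ → sym (∑-δ (λ k → y ^ (k ℕ.+ 1) * t ^ nlc T) {tc T} (s≤s (≤-/2 (tc-bound′ T T∈))))) ⟩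
    ⅀ (trees (suc n)) (λ T → ∑[ k ≤ n ℕ./ 2 ] (y ^ (toℕ k ℕ.+ 1) * t ^ nlc T * δ (tc T) (toℕ k)))
      ≈⟨ ⅀-∑ (trees (suc n)) {suc (n ℕ./ 2)} (λ T k → y ^ (toℕ k ℕ.+ 1) * t ^ nlc T * δ (tc T) (toℕ k)) ⟩
    ∑[ k ≤ n ℕ./ 2 ] ⅀ (trees (suc n)) (λ T → y ^ (toℕ k ℕ.+ 1) * t ^ nlc T * δ (tc T) (toℕ k))
      ≈⟨ sum-cong-≋ {suc (n ℕ./ 2)} (λ k → term (toℕ k)) ⟩
    ∑[ k ≤ n ℕ./ 2 ] (ν (γ-coefficient n (toℕ k)) * y ^ (toℕ k ℕ.+ 1) * t ^ (toℕ k ℕ.+ 1) * (1# + t) ^ (n ∸ 2 ℕ.* toℕ k)) ∎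
    where
    open Forests using (tc-bound)
    tc-bound′ : ∀ T → T ∈ trees (suc n) → 2 ℕ.* tc T ≤ n
    tc-bound′ empty        T∈ with () ← ∈-trees⁻ {suc n} T∈
    tc-bound′ T@(node l r) T∈ = ℕ.≤-trans (ℕ.≤-reflexive (≡.cong (tc T ℕ.+_) (ℕ.+-identityʳ (tc T))))
      (ℕ.≤-pred (≡.subst (tc T ℕ.+ tc T <_) (∈-trees⁻ T∈) (tc-bound l r)))
    term : ∀ k → ⅀ (trees (suc n)) (λ T → y ^ (k ℕ.+ 1) * t ^ nlc T * δ (tc T) k) ≈
           ν (γ-coefficient n k) * y ^ (k ℕ.+ 1) * t ^ (k ℕ.+ 1) * (1# + t) ^ (n ∸ 2 ℕ.* k)
    term k = begin
      ⅀ (trees (suc n)) (λ T → y ^ (k ℕ.+ 1) * t ^ nlc T * δ (tc T) k)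
        ≈⟨ ⅀-cong (trees (suc n)) (λ T _ → trans (*-assoc _ _ _) (*-congˡ (*-comm _ _))) ⟩
      ⅀ (trees (suc n)) (λ T → y ^ (k ℕ.+ 1) * (δ (tc T) k * t ^ nlc T))
        ≈⟨ ⅀-distribˡ (y ^ (k ℕ.+ 1)) (trees (suc n)) _ ⟨
      y ^ (k ℕ.+ 1) * ⅀ (trees (suc n)) (λ T → δ (tc T) k * t ^ nlc T)
        ≈⟨ *-congˡ (trees-sum t n k) ⟩
      y ^ (k ℕ.+ 1) * (ν (ballot k 0) * (ν (n C (2 ℕ.* k)) * (1# + t) ^ (n ∸ 2 ℕ.* k)) * t ^ (k ℕ.+ 1))
        ≈⟨ solveR 5 (λ a b c d e → a :* (b :* (c :* d) :* e) := b :* c :* a :* e :* d) refl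
             (y ^ (k ℕ.+ 1)) (ν (ballot k 0)) (ν (n C (2 ℕ.* k))) ((1# + t) ^ (n ∸ 2 ℕ.* k)) (t ^ (k ℕ.+ 1)) ⟩
      ν (ballot k 0) * ν (n C (2 ℕ.* k)) * y ^ (k ℕ.+ 1) * t ^ (k ℕ.+ 1) * (1# + t) ^ (n ∸ 2 ℕ.* k)
        ≈⟨ *-congʳ (*-congʳ (*-congʳ (ν-* (ballot k 0) (n C (2 ℕ.* k))))) ⟨
      ν (γ-coefficient n k) * y ^ (k ℕ.+ 1) * t ^ (k ℕ.+ 1) * (1# + t) ^ (n ∸ 2 ℕ.* k) ∎

  T≈γ : ∀ n y t → T⟨tc,nlc⟩ A (suc n) y t ≈ γ n (y * t) (1# + t)
  T≈γ n y t = trans (tree-polynomial n y t) (sum-cong-≋ {suc (n ℕ./ 2)} (λ k → term (toℕ k)))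
    where
    term : ∀ k → ν (γ-coefficient n k) * y ^ (k ℕ.+ 1) * t ^ (k ℕ.+ 1) * (1# + t) ^ (n ∸ 2 ℕ.* k) ≈
           ν (γ-coefficient n k) * ((y * t) ^ suc k * (1# + t) ^ (n ∸ 2 ℕ.* k))
    term k = begin
      c * y ^ (k ℕ.+ 1) * t ^ (k ℕ.+ 1) * x      ≡⟨ ≡.cong (λ e → c * y ^ e * t ^ e * x) (ℕ.+-comm k 1) ⟩
      c * y ^ suc k * t ^ suc k * x              ≈⟨ trans (*-congʳ (*-assoc _ _ _)) (*-assoc _ _ _) ⟩
      c * (y ^ suc k * t ^ suc k * x)            ≈⟨ *-congˡ (*-congʳ (^-distrib-* y t (suc k))) ⟨
      c * ((y * t) ^ suc k * x)                  ∎
      where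
      c = ν (γ-coefficient n k)
      x = (1# + t) ^ (n ∸ 2 ℕ.* k)

  -- Expanding the powers of 1 + t and exchanging the two sums reduces the claim to the coefficient
  -- of t^(i + 1), which is `narayana-sum` with a = i and l = n - i.
  Narayana≈γ : ∀ n t → Narayana A (suc n) t ≈ γ n t (1# + t)
  Narayana≈γ n t = begin
    ι (+ 1 ℚ./ suc n) * ∑[ i < suc n ] (ι (+ M (toℕ i) ℚ./ 1) * t ^ suc (toℕ i))
      ≈⟨ *-distribˡ-sum {suc n} (ι (+ 1 ℚ./ suc n)) (λ i → ι (+ M (toℕ i) ℚ./ 1) * t ^ suc (toℕ i)) ⟩
    ∑[ i < suc n ] (ι (+ 1 ℚ./ suc n) * (ι (+ M (toℕ i) ℚ./ 1) * t ^ suc (toℕ i)))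
      ≈⟨ sum-cong-≋ {suc n} (λ i → Narayana-term (toℕ i) (toℕ<n i)) ⟩
    ∑[ i < suc n ] (∑[ k ≤ K ] ν (c (toℕ k) (toℕ i)) * t ^ suc (toℕ i))
      ≈⟨ sum-cong-≋ {suc n} (λ i → *-distribʳ-sum {suc K} (t ^ suc (toℕ i)) (λ k → ν (c (toℕ k) (toℕ i)))) ⟩
    ∑[ i < suc n ] ∑[ k ≤ K ] (ν (c (toℕ k) (toℕ i)) * t ^ suc (toℕ i))
      ≈⟨ ∑-comm {suc n} {suc K} (λ i k → ν (c (toℕ k) (toℕ i)) * t ^ suc (toℕ i)) ⟩
    ∑[ k ≤ K ] ∑[ i < suc n ] (ν (c (toℕ k) (toℕ i)) * t ^ suc (toℕ i))
      ≈⟨ sum-cong-≋ {suc K} (λ k → γ-term (toℕ k) (2*-≤ (toℕ<n k))) ⟨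
    γ n t (1# + t) ∎
    where
    K = n ℕ./ 2
    M : ℕ → ℕ
    M i = (suc n C suc i) ℕ.* (suc n C i)
    c : ℕ → ℕ → ℕ
    c k i = γ-coefficient n k ℕ.* shiftedC (n ∸ 2 ℕ.* k) i k
    Narayana-term : ∀ i → i < suc n → ι (+ 1 ℚ./ suc n) * (ι (+ M i ℚ./ 1) * t ^ suc i) ≈
                    ∑[ k ≤ K ] ν (c (toℕ k) i) * t ^ suc i
    Narayana-term i (s≤s i≤n) = begin
      ι (+ 1 ℚ./ suc n) * (ι (+ M i ℚ./ 1) * t ^ suc i)
        ≈⟨ *-assoc _ _ _ ⟨
      ι (+ 1 ℚ./ suc n) * ι (+ M i ℚ./ 1) * t ^ suc i
        ≈⟨ *-congʳ (ι.*-homo (+ 1 ℚ./ suc n) (+ M i ℚ./ 1)) ⟨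
      ι ((+ 1 ℚ./ suc n) ℚ.* (+ M i ℚ./ 1)) * t ^ suc i
        ≡⟨ ≡.cong (λ q → ι q * t ^ suc i) (exact-product {n} (exact i≤n)) ⟩
      ι (+ ℕΣ.sum {suc K} (λ k → c (toℕ k) i) ℚ./ 1) * t ^ suc i
        ≈⟨ *-congʳ (ν≈ι (ℕΣ.sum {suc K} (λ k → c (toℕ k) i))) ⟨
      ν (ℕΣ.sum {suc K} (λ k → c (toℕ k) i)) * t ^ suc i
        ≈⟨ *-congʳ (ν-∑ (λ k → c k i) (suc K)) ⟩
      ∑[ k ≤ K ] ν (c (toℕ k) i) * t ^ suc i ∎
      where
      exact : i ≤ n → suc n ℕ.* ℕΣ.sum {suc K} (λ k → c (toℕ k) i) ≡ M i
      exact i≤n with l , ≡.refl ← ℕ.m≤n⇒∃[o]m+o≡n i≤n = narayana-sum i l K (<-2*[1+n/2] (i ℕ.+ l))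
    γ-term : ∀ k → 2 ℕ.* k ≤ n → ν (γ-coefficient n k) * (t ^ suc k * (1# + t) ^ (n ∸ 2 ℕ.* k)) ≈
             ∑[ i < suc n ] (ν (c k (toℕ i)) * t ^ suc (toℕ i))
    γ-term k 2k≤n = begin
      b * (t * t ^ k * (1# + t) ^ m)
        ≈⟨ *-congˡ (trans (*-assoc _ _ _) (*-congˡ (shifted-power t m k (suc n) (s≤s k+m≤n)))) ⟩
      b * (t * ∑[ i < suc n ] (ν (shiftedC m (toℕ i) k) * t ^ toℕ i))
        ≈⟨ trans (sym (*-assoc _ _ _)) (*-distribˡ-sum {suc n} (b * t) (λ i → ν (shiftedC m (toℕ i) k) * t ^ toℕ i)) ⟩
      ∑[ i < suc n ] (b * t * (ν (shiftedC m (toℕ i) k) * t ^ toℕ i))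
        ≈⟨ sum-cong-≋ {suc n} (λ i → trans
             (solveR 4 (λ a b c d → a :* b :* (c :* d) := a :* c :* (b :* d)) refl b t (ν (shiftedC m (toℕ i) k)) (t ^ toℕ i))
             (*-congʳ (sym (ν-* (γ-coefficient n k) (shiftedC m (toℕ i) k))))) ⟩
      ∑[ i < suc n ] (ν (c k (toℕ i)) * t ^ suc (toℕ i)) ∎
      where
      b = ν (γ-coefficient n k)
      m = n ∸ 2 ℕ.* k
      k+m≤n : k ℕ.+ m ≤ n
      k+m≤n = ℕ.≤-trans (ℕ.+-monoˡ-≤ m (ℕ.m≤m+n k (k ℕ.+ 0))) (ℕ.≤-reflexive (ℕ.m+[n∸m]≡n 2k≤n))

-- Polynomial identities between √, u, v and w

module Solver (A : ℚ-Algebra) where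
  open ℚ-Algebra A hiding (zero)
  private module ι = IsRingHomomorphism ι-homo

  -- Agrees with ι, but sends the literals 0 and 1 to 0# and 1# on the nose.
  ⟦_⟧ : ℚ.ℚ → Carrier
  ⟦ ℚ.mkℚ (+ 0) 0 _ ⟧ = 0#
  ⟦ ℚ.mkℚ (+ 1) 0 _ ⟧ = 1#
  ⟦ q ⟧               = ι q

  ⟦⟧≈ι : ∀ q → ⟦ q ⟧ ≈ ι q
  ⟦⟧≈ι (ℚ.mkℚ (+ 0)             0       _) = sym ι.0#-homo
  ⟦⟧≈ι (ℚ.mkℚ (+ 0)             (suc _) _) = refl
  ⟦⟧≈ι (ℚ.mkℚ (+ 1)             0       _) = sym ι.1#-homo
  ⟦⟧≈ι (ℚ.mkℚ (+ 1)             (suc _) _) = refl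
  ⟦⟧≈ι (ℚ.mkℚ (+ suc (suc _))   _       _) = refl
  ⟦⟧≈ι (ℚ.mkℚ ℤ.-[1+ _ ]        _       _) = refl

  homomorphism : ℚ.+-*-rawRing -Raw-AlmostCommutative⟶ fromCommutativeRing commutativeRing
  homomorphism = record
    { ⟦_⟧    = ⟦_⟧
    ; +-homo = λ p q → trans (⟦⟧≈ι (p ℚ.+ q)) (trans (ι.+-homo p q) (sym (+-cong (⟦⟧≈ι p) (⟦⟧≈ι q))))
    ; *-homo = λ p q → trans (⟦⟧≈ι (p ℚ.* q)) (trans (ι.*-homo p q) (sym (*-cong (⟦⟧≈ι p) (⟦⟧≈ι q))))
    ; -‿homo = λ p → trans (⟦⟧≈ι (ℚ.- p)) (trans (ι.-‿homo p) (sym (-‿cong (⟦⟧≈ι p))))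
    ; 0-homo = refl
    ; 1-homo = refl
    }

  _coeff≟_ : ∀ p q → Maybe (⟦ p ⟧ ≈ ⟦ q ⟧)
  p coeff≟ q with p ℚ.≟ q
  ... | yes ≡.refl = just refl
  ... | no _       = nothing

  open RingSolver ℚ.+-*-rawRing (fromCommutativeRing commutativeRing) homomorphism _coeff≟_ public
    using (solve; _:+_; _:*_; _:-_; _:^_; _:=_; con)

module QuadraticIdentities (A : ℚ-Algebra) where
  open ℚ-Algebra A hiding (zero)
  open Solver A renaming (solve to solveR)
  open RingProperties ring using (+-cancelʳ)
  open import Relation.Binary.Reasoning.Setoid setoid

  module _ (y t √ u v : Carrier)
    (√-square : √ ^ 2 ≈ (1# + t) ^ 2 - 4# * y * t)
    (u-eq : 2# * (1# - y) * t * u ≈ 1# + t ^ 2 - 2# * y * t - (1# - t) * √)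
    (v-eq : 2# * y * t * v ≈ (1# + t) ^ 2 - 2# * y * t - (1# + t) * √)
    where

    private
      D = 2# * (1# - y) * t
      E = 2# * y * t

    -- This is w(1 + v) = 1 + t with all denominators cleared; the factors D and E turn u and v into
    -- their numerators.
    product-identity : D * E * ((1# + t) * (1# + u * v)) ≈ D * E * ((1# + u) * (1# + v))
    product-identity = begin
      D * E * ((1# + t) * (1# + u * v))
        ≈⟨ solveR 5 (λ d e t u v → d :* e :* ((con ℚ.1ℚ :+ t) :* (con ℚ.1ℚ :+ u :* v)) :=
             (con ℚ.1ℚ :+ t) :* (d :* e :+ (d :* u) :* (e :* v))) refl D E t u v ⟩
      (1# + t) * (D * E + (D * u) * (E * v))
        ≈⟨ *-congˡ (+-congˡ (*-cong u-eq v-eq)) ⟩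
      (1# + t) * (D * E + a * b)
        -- To the solver √ is a free variable. Its relation enters by adding c √² on both sides and
        -- replacing it by the discriminant on the left only.
        ≈⟨ +-cancelʳ (c * √ ^ 2) _ _ (trans (+-congˡ (*-congˡ √-square)) identity) ⟩
      (D + a) * (E + b)
        ≈⟨ *-cong (+-congˡ u-eq) (+-congˡ v-eq) ⟨
      (D + D * u) * (E + E * v)
        ≈⟨ solveR 4 (λ d e u v → (d :+ d :* u) :* (e :+ e :* v) :=
             d :* e :* ((con ℚ.1ℚ :+ u) :* (con ℚ.1ℚ :+ v))) refl D E u v ⟩
      D * E * ((1# + u) * (1# + v)) ∎
      where
      a = 1# + t ^ 2 - 2# * y * t - (1# - t) * √
      b = (1# + t) ^ 2 - 2# * y * t - (1# + t) * √
      -- The difference of the coefficients of √² on the two sides, (1 + t)² (1 - t) and (1 + t) (1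
      -- - t).
      c = t * ((1# - t) * (1# + t))
      identity : (1# + t) * (D * E + a * b) + c * ((1# + t) ^ 2 - 4# * y * t) ≈ (D + a) * (E + b) + c * √ ^ 2
      identity = solveR 3 (λ y t r →
        let 1: = con ℚ.1ℚ
            2: = 1: :+ 1:
            d = 2: :* (1: :- y) :* t
            e = 2: :* y :* t
            a = 1: :+ t :^ 2 :- 2: :* y :* t :- (1: :- t) :* r
            b = (1: :+ t) :^ 2 :- 2: :* y :* t :- (1: :+ t) :* r
            c = t :* ((1: :- t) :* (1: :+ t))
        in (1: :+ t) :* (d :* e :+ a :* b) :+ c :* ((1: :+ t) :^ 2 :- (2: :+ 2:) :* y :* t) :=
           (d :+ a) :* (e :+ b) :+ c :* r :^ 2) refl y t √

    -- Eliminating w from w²v = yt and w(1 + v) = 1 + t leaves this quadratic equation for v.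
    square-identity : E * E * (y * t * ((1# + v) * (1# + v))) ≈ E * E * ((1# + t) * (1# + t) * v)
    square-identity = begin
      E * E * (y * t * ((1# + v) * (1# + v)))
        ≈⟨ solveR 4 (λ e y t v → e :* e :* (y :* t :* ((con ℚ.1ℚ :+ v) :* (con ℚ.1ℚ :+ v))) :=
             y :* t :* ((e :+ e :* v) :* (e :+ e :* v))) refl E y t v ⟩
      y * t * ((E + E * v) * (E + E * v))
        ≈⟨ *-congˡ (*-cong (+-congˡ v-eq) (+-congˡ v-eq)) ⟩
      y * t * ((E + b) * (E + b))
        ≈⟨ +-cancelʳ (c * √ ^ 2) _ _ (trans (+-congˡ (*-congˡ √-square)) identity) ⟩
      E * ((1# + t) * (1# + t) * b)
        ≈⟨ *-congˡ (*-congˡ v-eq) ⟨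
      E * ((1# + t) * (1# + t) * (E * v))
        ≈⟨ solveR 3 (λ e s v → e :* (s :* (e :* v)) := e :* e :* (s :* v)) refl E ((1# + t) * (1# + t)) v ⟩
      E * E * ((1# + t) * (1# + t) * v) ∎
      where
      b = (1# + t) ^ 2 - 2# * y * t - (1# + t) * √
      -- The coefficient of √² on the left; the right side is linear in √.
      c = y * t * ((1# + t) * (1# + t))
      identity : y * t * ((E + b) * (E + b)) + c * ((1# + t) ^ 2 - 4# * y * t) ≈
                 E * ((1# + t) * (1# + t) * b) + c * √ ^ 2
      identity = solveR 3 (λ y t r →
        let 1: = con ℚ.1ℚ
            2: = 1: :+ 1:
            e = 2: :* y :* t
            b = (1: :+ t) :^ 2 :- 2: :* y :* t :- (1: :+ t) :* r
            c = y :* t :* ((1: :+ t) :* (1: :+ t))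
        in y :* t :* ((e :+ b) :* (e :+ b)) :+ c :* ((1: :+ t) :^ 2 :- (2: :+ 2:) :* y :* t) :=
           e :* ((1: :+ t) :* (1: :+ t) :* b) :+ c :* r :^ 2) refl y t √

  -- The solution K ≈ t + … of a quadratic equation without denominators, in terms of
  -- which √, u, v and w are polynomials.
  module Solution (y t K : Carrier)
    (K-eq : K ≈ t * (1# - K + 2# * y * K - y * (1# - y) * (K * K))) where

    -- As (1 + t)² - 4yt = (1 + t - 2yt)² + 4y(1 - y)t², the root differs from 1 + t - 2yt by a
    -- multiple of 2y(1 - y)t, and K is that quotient. Substituting it makes the denominators of u
    -- and v cancel, and w is (1 + t + √)/2.
    √ u v w : Carrier
    √ = 1# + t - 2# * y * t + 2# * y * (1# - y) * t * K
    u = t - y * (1# - t) * K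
    v = t - (1# + t) * (1# - y) * K
    w = 1# + t - y * t + y * (1# - y) * t * K

    √-square : √ ^ 2 ≈ (1# + t) ^ 2 - 4# * y * t
    √-square = +-cancelʳ (c * (t * (1# - K + 2# * y * K - y * (1# - y) * (K * K)))) _ _
      (trans identity (+-congˡ (*-congˡ K-eq)))
      where
      c = 4# * y * (1# - y) * t
      identity : √ ^ 2 + c * (t * (1# - K + 2# * y * K - y * (1# - y) * (K * K))) ≈
                 (1# + t) ^ 2 - 4# * y * t + c * K
      identity = solveR 3 (λ y t k →
        let 1: = con ℚ.1ℚ
            2: = 1: :+ 1:
            c = (2: :+ 2:) :* y :* (1: :- y) :* t
        in (1: :+ t :- 2: :* y :* t :+ 2: :* y :* (1: :- y) :* t :* k) :^ 2 :+
           c :* (t :* (1: :- k :+ 2: :* y :* k :- y :* (1: :- y) :* (k :* k))) :=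
           (1: :+ t) :^ 2 :- (2: :+ 2:) :* y :* t :+ c :* k) refl y t K

    u-eq : 2# * (1# - y) * t * u ≈ 1# + t ^ 2 - 2# * y * t - (1# - t) * √
    u-eq = solveR 3 (λ y t k →
        let 1: = con ℚ.1ℚ
            2: = 1: :+ 1:
        in 2: :* (1: :- y) :* t :* (t :- y :* (1: :- t) :* k) :=
           1: :+ t :^ 2 :- 2: :* y :* t :- (1: :- t) :* (1: :+ t :- 2: :* y :* t :+ 2: :* y :* (1: :- y) :* t :* k))
        refl y t K

    v-eq : 2# * y * t * v ≈ (1# + t) ^ 2 - 2# * y * t - (1# + t) * √
    v-eq = solveR 3 (λ y t k →
        let 1: = con ℚ.1ℚ
            2: = 1: :+ 1:
        in 2: :* y :* t :* (t :- (1: :+ t) :* (1: :- y) :* k) :=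
           (1: :+ t) :^ 2 :- 2: :* y :* t :- (1: :+ t) :* (1: :+ t :- 2: :* y :* t :+ 2: :* y :* (1: :- y) :* t :* k))
        refl y t K

    w-eq : (1# + u * v) * w ≈ 1# + u
    w-eq = +-cancelʳ (c * (t * (1# - K + 2# * y * K - y * (1# - y) * (K * K)))) _ _
      (trans identity (+-congˡ (*-congˡ K-eq)))
      where
      -- The quotient of (1 + uv) w - (1 + u), a cubic in K, by the quadratic relation for K.
      c = y * (1# - y) * (1# - t ^ 2) * K + (y - t - t ^ 2 + y * t ^ 2)
      identity : (1# + u * v) * w + c * (t * (1# - K + 2# * y * K - y * (1# - y) * (K * K))) ≈ 1# + u + c * K
      identity = solveR 3 (λ y t k →
        let 1: = con ℚ.1ℚ
            2: = 1: :+ 1: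
            c = y :* (1: :- y) :* (1: :- t :^ 2) :* k :+ (y :- t :- t :^ 2 :+ y :* t :^ 2)
            u = t :- y :* (1: :- t) :* k
            v = t :- (1: :+ t) :* (1: :- y) :* k
        in (1: :+ u :* v) :* (1: :+ t :- y :* t :+ y :* (1: :- y) :* t :* k) :+
           c :* (t :* (1: :- k :+ 2: :* y :* k :- y :* (1: :- y) :* (k :* k))) :=
           1: :+ u :+ c :* k) refl y t K

    -- K, hence u, is a multiple of t. In power series this gives 1 + uv the constant term 1, so
    -- that it is a legitimate denominator.
    t∣uv : 1# + u * v ≈ 1# + t * ((1# - y * (1# - t) * (1# - K + 2# * y * K - y * (1# - y) * (K * K))) * v)
    t∣uv = +-congˡ (trans (*-congʳ (+-congˡ (-‿cong (*-congˡ K-eq))))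
      (solveR 4 (λ y t f v → let 1: = con ℚ.1ℚ in
        (t :- y :* (1: :- t) :* (t :* f)) :* v := t :* ((1: :- y :* (1: :- t) :* f) :* v)) refl y t
        (1# - K + 2# * y * K - y * (1# - y) * (K * K)) v))

    √-constant : √ ≈ 1# + t * (1# - 2# * y + 2# * y * (1# - y) * K)
    √-constant = solveR 3 (λ y t k →
        let 1: = con ℚ.1ℚ
            2: = 1: :+ 1:
        in 1: :+ t :- 2: :* y :* t :+ 2: :* y :* (1: :- y) :* t :* k :=
           1: :+ t :* (1: :- 2: :* y :+ 2: :* y :* (1: :- y) :* k)) refl y t K

-- The transformation for given parameters in an integral domain

module Cancellation (D : IntegralDomain) where
  open IntegralDomain D
  open RingProperties ring using (x∙y⁻¹≈ε⇒x≈y; x[y-z]≈xy-xz)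

  -- The absence of zero divisors only refutes `x ≉ y`; stability of equality removes the double
  -- negation.
  *-cancelˡ : ∀ {a x y} → a ≉ 0# → a * x ≈ a * y → x ≈ y
  *-cancelˡ {a} {x} {y} a≉0 ax≈ay = ≈-stable λ x≉y →
    *-≉0 a≉0 (λ x-y≈0 → x≉y (x∙y⁻¹≈ε⇒x≈y x y x-y≈0))
      (trans (x[y-z]≈xy-xz a x y) (trans (+-congʳ ax≈ay) (-‿inverseʳ (a * y))))

module ParameterIdentities (D : IntegralDomain)
  (ι : ℚ.ℚ → IntegralDomain.Carrier D) (ι-homo : IsRingHomomorphism ℚ.+-*-rawRing (IntegralDomain.rawRing D) ι)
  where

  algebra : ℚ-Algebra
  algebra = record { commutativeRing = IntegralDomain.commutativeRing D ; ι = ι ; ι-homo = ι-homo }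

  open ℚ-Algebra algebra using (_^_; 2#; 4#)
  open IntegralDomain D
  open Cancellation D
  open Evaluation algebra
  open import Relation.Binary.Reasoning.Setoid setoid

  module _ {y t √ u v w : Carrier}
    (√-square : √ ^ 2 ≈ (1# + t) ^ 2 - 4# * y * t)
    (u-quotient : u IsQuotient (1# + t ^ 2 - 2# * y * t - (1# - t) * √) / (2# * (1# - y) * t))
    (v-quotient : v IsQuotient ((1# + t) ^ 2 - 2# * y * t - (1# + t) * √) / (2# * y * t))
    (w-quotient : w IsQuotient (1# + u) / (1# + u * v))
    (1+t≉0 : 1# + t ≉ 0#)
    where

    private
      D≉0 = proj₁ u-quotient
      E≉0 = proj₁ v-quotient

    w[1+v]≈1+t : w * (1# + v) ≈ 1# + t
    w[1+v]≈1+t = *-cancelˡ (proj₁ w-quotient) (begin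
      (1# + u * v) * (w * (1# + v))    ≈⟨ *-assoc _ _ _ ⟨
      (1# + u * v) * w * (1# + v)      ≈⟨ *-congʳ (proj₂ w-quotient) ⟩
      (1# + u) * (1# + v)
        ≈⟨ *-cancelˡ (*-≉0 D≉0 E≉0)
             (QuadraticIdentities.product-identity algebra y t √ u v √-square (proj₂ u-quotient) (proj₂ v-quotient)) ⟨
      (1# + t) * (1# + u * v)          ≈⟨ *-comm _ _ ⟩
      (1# + u * v) * (1# + t)          ∎)

    1+v≉0 : 1# + v ≉ 0#
    1+v≉0 1+v≈0 = 1+t≉0 (trans (sym w[1+v]≈1+t) (trans (*-congˡ 1+v≈0) (zeroʳ w)))

    -- After multiplication by (1 + v)² the left side is (1 + t)² v, and `square-identity` applies.
    -- The factor can be cancelled because w(1 + v) = 1 + t is nonzero.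
    wwv≈yt : w * w * v ≈ y * t
    wwv≈yt = *-cancelˡ (*-≉0 1+v≉0 1+v≉0) (begin
      (1# + v) * (1# + v) * (w * w * v)
        ≈⟨ solveR 3 (λ a w v → a :* a :* (w :* w :* v) := (w :* a) :* (w :* a) :* v) refl (1# + v) w v ⟩
      w * (1# + v) * (w * (1# + v)) * v
        ≈⟨ *-congʳ (*-cong w[1+v]≈1+t w[1+v]≈1+t) ⟩
      (1# + t) * (1# + t) * v
        ≈⟨ *-cancelˡ (*-≉0 E≉0 E≉0)
             (QuadraticIdentities.square-identity algebra y t √ u v √-square (proj₂ u-quotient) (proj₂ v-quotient)) ⟨
      y * t * ((1# + v) * (1# + v))
        ≈⟨ *-comm _ _ ⟩
      (1# + v) * (1# + v) * (y * t) ∎)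
      where open SemiringSolver commutativeSemiring using (_:*_; _:=_) renaming (solve to solveR)

    T≈w*Narayana : ∀ n → T⟨tc,nlc⟩ algebra (suc n) y t ≈ w ^ (suc n ℕ.+ 1) * Narayana algebra (suc n) v
    T≈w*Narayana n = begin
      T⟨tc,nlc⟩ algebra (suc n) y t                    ≈⟨ T≈γ n y t ⟩
      γ n (y * t) (1# + t)                             ≈⟨ γ-cong n wwv≈yt w[1+v]≈1+t ⟨
      γ n (w * w * v) (w * (1# + v))                   ≈⟨ γ-homogeneous n w v (1# + v) ⟩
      w ^ (suc n ℕ.+ 1) * γ n v (1# + v)               ≈⟨ *-congˡ (Narayana≈γ n v) ⟨
      w ^ (suc n ℕ.+ 1) * Narayana algebra (suc n) v   ∎

-- Fixed points of contractions on power series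

module SeriesProperties (D : IntegralDomain) where
  private
    module D = IntegralDomain D
    module S = SemiringSum D.semiring
  open Series D
  private module Ser = CommutativeRing commutativeRing

  X*-zero : ∀ f → coeff (X * f) 0 D.≈ D.0#
  X*-zero f = D.trans (D.+-identityʳ _) (D.zeroˡ _)

  X*-suc : ∀ f n → coeff (X * f) (suc n) D.≈ coeff f n
  X*-suc f n = D.trans (D.+-cong (D.zeroˡ _) (S.sum-cong-≋ {suc n} (λ i → D.*-congʳ {coeff f (n ∸ toℕ i)} (shift (toℕ i)))))
    (D.trans (D.+-identityˡ _) (at (Ser.*-identityˡ f) n))
    where
    shift : ∀ i → indeterminate (suc i) D.≈ constant D.1# i
    shift zero    = D.refl
    shift (suc i) = D.refl

  1+X*f≉0 : ∀ f → ¬ (1ₛ + X * f ≈ₛ 0ₛ)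
  1+X*f≉0 f eq = D.1≉0 (D.trans (D.sym (D.trans (D.+-congˡ (X*-zero f)) (D.+-identityʳ _))) (at eq 0))

  infix 4 _≈[_]_
  _≈[_]_ : Series → ℕ → Series → Set
  f ≈[ n ] g = ∀ i → i < n → coeff f i D.≈ coeff g i

  -- Such maps are nonexpansive in the X-adic metric, so following them by multiplication with X
  -- gives a contraction.
  record Causal (Φ : Series → Series) : Set where
    constructor causal
    field respects : ∀ n f g → f ≈[ n ] g → Φ f ≈[ n ] Φ g
  open Causal

  id-causal : Causal (λ f → f)
  id-causal = causal λ n f g f≈g → f≈g

  const-causal : ∀ h → Causal (λ _ → h)
  const-causal h = causal λ n f g f≈g i i<n → D.refl

  +-causal : ∀ {Φ Ψ} → Causal Φ → Causal Ψ → Causal (λ f → Φ f + Ψ f)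
  +-causal Φ-causal Ψ-causal = causal λ n f g f≈g i i<n →
    D.+-cong (respects Φ-causal n f g f≈g i i<n) (respects Ψ-causal n f g f≈g i i<n)

  -‿causal : ∀ {Φ} → Causal Φ → Causal (λ f → - Φ f)
  -‿causal Φ-causal = causal λ n f g f≈g i i<n → D.-‿cong (respects Φ-causal n f g f≈g i i<n)

  *-causal : ∀ {Φ Ψ} → Causal Φ → Causal Ψ → Causal (λ f → Φ f * Ψ f)
  *-causal Φ-causal Ψ-causal = causal λ n f g f≈g i i<n → S.sum-cong-≋ {suc i} λ j → D.*-cong
    (respects Φ-causal n f g f≈g (toℕ j) (ℕ.<-≤-trans (toℕ<n j) i<n))
    (respects Ψ-causal n f g f≈g (i ∸ toℕ j) (ℕ.≤-<-trans (ℕ.m∸n≤m i (toℕ j)) i<n))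

  X*-advances : ∀ n f g → f ≈[ n ] g → X * f ≈[ suc n ] X * g
  X*-advances n f g f≈g zero    _         = D.trans (X*-zero f) (D.sym (X*-zero g))
  X*-advances n f g f≈g (suc i) (s≤s i<n) = D.trans (X*-suc f i) (D.trans (f≈g i i<n) (D.sym (X*-suc g i)))

  module FixedPoint {Φ} (Φ-causal : Causal Φ) where
    approximation : ℕ → Series
    approximation zero    = 0ₛ
    approximation (suc n) = X * Φ (approximation n)

    approximation-step : ∀ n → approximation n ≈[ n ] approximation (suc n)
    approximation-step zero    i ()
    approximation-step (suc n) = X*-advances n (Φ (approximation n)) (Φ (approximation (suc n)))
      (respects Φ-causal n (approximation n) (approximation (suc n)) (approximation-step n))

    approximation-stable : ∀ m n i → i < n → coeff (approximation n) i D.≈ coeff (approximation (m ℕ.+ n)) i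
    approximation-stable zero    n i i<n = D.refl
    approximation-stable (suc m) n i i<n = D.trans (approximation-stable m n i i<n)
      (approximation-step (m ℕ.+ n) i (ℕ.<-≤-trans i<n (ℕ.m≤n+m n m)))

    -- Coefficient n no longer changes from approximation n + 1 onwards, so the diagonal is the
    -- limit.
    fixedPoint : Series
    fixedPoint = series λ n → coeff (approximation (suc n)) n

    fixedPoint-approximation : ∀ n → fixedPoint ≈[ n ] approximation n
    fixedPoint-approximation n i i<n with m , ≡.refl ← ℕ.m≤n⇒∃[o]m+o≡n i<n =
      D.trans (approximation-stable m (suc i) i ℕ.≤-refl)
        (D.reflexive (≡.cong (λ k → coeff (approximation k) i) (ℕ.+-comm m (suc i))))

    fixedPoint-equation : fixedPoint ≈ₛ X * Φ fixedPoint
    fixedPoint-equation = coeffwise λ n → D.sym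
      (X*-advances n (Φ fixedPoint) (Φ (approximation n))
        (respects Φ-causal n fixedPoint (approximation n) (fixedPoint-approximation n)) n ℕ.≤-refl)

-- Counting trees by coefficients of power series

module TreeCounts (D : IntegralDomain) where
  private module D = IntegralDomain D
  open Series D hiding (C)
  open SeriesProperties D
  private
    module Ser = CommutativeRing commutativeRing
    module S = SemiringSum D.semiring
    module Sₛ = SemiringSum Ser.semiring
    module ℒ = ListSum D.commutativeSemiring
    module ℒₛ = ListSum Ser.commutativeSemiring
    module 𝒞ₛ = Coefficients Ser.commutativeSemiring
  open Coefficients D.commutativeSemiring
  open ForestSum Ser.commutativeSemiring X using (trees-sum; shifted-power)
  open SemiringExp Ser.semiring using (_^_)
  open Binomials

  coeff-ν* : ∀ b f j → coeff (𝒞ₛ.ν b * f) j D.≈ ν b D.* coeff f j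
  coeff-ν* zero    f j = D.trans (at (Ser.zeroˡ f) j) (D.trans (constant-0 j) (D.sym (D.zeroˡ _)))
  coeff-ν* (suc b) f j = D.trans (at (Ser.distribʳ f 1ₛ (𝒞ₛ.ν b)) j)
    (D.trans (D.+-cong (D.trans (at (Ser.*-identityˡ f) j) (D.sym (D.*-identityˡ _))) (coeff-ν* b f j))
      (D.sym (D.distribʳ (coeff f j) D.1# (ν b))))

  coeff-δ* : ∀ a k f j → coeff (𝒞ₛ.δ a k * f) j D.≈ δ a k D.* coeff f j
  coeff-δ* zero    zero    f j = D.trans (at (Ser.*-identityˡ f) j) (D.sym (D.*-identityˡ _))
  coeff-δ* zero    (suc k) f j = D.trans (at (Ser.zeroˡ f) j) (D.trans (constant-0 j) (D.sym (D.zeroˡ _)))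
  coeff-δ* (suc a) zero    f j = D.trans (at (Ser.zeroˡ f) j) (D.trans (constant-0 j) (D.sym (D.zeroˡ _)))
  coeff-δ* (suc a) (suc k) f j = coeff-δ* a k f j

  coeff-X^ : ∀ a j → coeff (X ^ a) j D.≈ δ j a
  coeff-X^ zero    zero    = D.refl
  coeff-X^ zero    (suc j) = D.refl
  coeff-X^ (suc a) zero    = X*-zero (X ^ a)
  coeff-X^ (suc a) (suc j) = D.trans (X*-suc (X ^ a) j) (coeff-X^ a j)

  coeff-∑ : ∀ n (f : ℕ → Series) j → coeff (Sₛ.sum {n} (f ∘ toℕ)) j D.≈ S.sum {n} (λ i → coeff (f (toℕ i)) j)
  coeff-∑ zero    f j = constant-0 j
  coeff-∑ (suc n) f j = D.+-congˡ (coeff-∑ n (f ∘ suc) j)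

  coeff-⅀ : ∀ {A : Set} xs (f : A → Series) j → coeff (ℒₛ.⅀ xs f) j D.≈ ℒ.⅀ xs (λ x → coeff (f x) j)
  coeff-⅀ []       f j = constant-0 j
  coeff-⅀ (x ∷ xs) f j = D.+-congˡ (coeff-⅀ xs f j)

  -- With the series variable X in the place of t, `trees-sum` becomes a generating function for
  -- `nlc`, and the count is its coefficient j.
  #trees-count : ∀ n k j → ν (#trees (suc n) k j) D.≈
    ν (ballot k 0 ℕ.* (n C (2 ℕ.* k)) ℕ.* shiftedC (n ∸ 2 ℕ.* k) j (k ℕ.+ 1))
  #trees-count n k j = begin
    ν (#trees (suc n) k j)
      ≈⟨ count (λ T → (tc T ℕ.≟ k) ×-dec (nlc T ℕ.≟ j)) (λ T → δ (tc T) k D.* δ j (nlc T)) indicator-1 indicator-0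
           (trees (suc n)) ⟩
    ℒ.⅀ (trees (suc n)) (λ T → δ (tc T) k D.* δ j (nlc T))
      ≈⟨ ℒ.⅀-cong (trees (suc n)) (λ T _ → D.trans (coeff-δ* (tc T) k (X ^ nlc T) j)
           (D.*-congˡ (coeff-X^ (nlc T) j))) ⟨
    ℒ.⅀ (trees (suc n)) (λ T → coeff (𝒞ₛ.δ (tc T) k * X ^ nlc T) j)
      ≈⟨ coeff-⅀ (trees (suc n)) (λ T → 𝒞ₛ.δ (tc T) k * X ^ nlc T) j ⟨
    coeff (ℒₛ.⅀ (trees (suc n)) (λ T → 𝒞ₛ.δ (tc T) k * X ^ nlc T)) j
      ≈⟨ at (trees-sum n k) j ⟩
    coeff (𝒞ₛ.ν b * (𝒞ₛ.ν c * (1ₛ + X) ^ m) * X ^ (k ℕ.+ 1)) j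
      ≈⟨ at regroup j ⟩
    coeff (𝒞ₛ.ν (b ℕ.* c) * Sₛ.sum {L} (s ∘ toℕ)) j
      ≈⟨ coeff-ν* (b ℕ.* c) (Sₛ.sum {L} (s ∘ toℕ)) j ⟩
    ν (b ℕ.* c) D.* coeff (Sₛ.sum {L} (s ∘ toℕ)) j
      ≈⟨ D.*-congˡ (coeff-∑ L s j) ⟩
    ν (b ℕ.* c) D.* S.sum {L} (λ a → coeff (s (toℕ a)) j)
      ≈⟨ D.*-congˡ (S.sum-cong-≋ {L} (λ a → D.trans
           (coeff-ν* (shiftedC m (toℕ a) (k ℕ.+ 1)) (X ^ toℕ a) j) (D.*-congˡ (coeff-X^ (toℕ a) j)))) ⟩
    ν (b ℕ.* c) D.* S.sum {L} (λ a → ν (shiftedC m (toℕ a) (k ℕ.+ 1)) D.* δ j (toℕ a))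
      ≈⟨ D.*-congˡ (∑-δ (λ a → ν (shiftedC m a (k ℕ.+ 1))) {j} {L} (s≤s (ℕ.m≤n+m j (k ℕ.+ 1 ℕ.+ m)))) ⟩
    ν (b ℕ.* c) D.* ν (shiftedC m j (k ℕ.+ 1))
      ≈⟨ ν-* (b ℕ.* c) (shiftedC m j (k ℕ.+ 1)) ⟨
    ν (b ℕ.* c ℕ.* shiftedC m j (k ℕ.+ 1)) ∎
    where
    open import Relation.Binary.Reasoning.Setoid D.setoid
    open SemiringSolver Ser.commutativeSemiring using (_:*_; _:=_) renaming (solve to solveR)
    b = ballot k 0
    c = n C (2 ℕ.* k)
    m = n ∸ 2 ℕ.* k
    -- Long enough both for the degree k + 1 + m and for the index j to be extracted.
    L = suc (k ℕ.+ 1 ℕ.+ m ℕ.+ j)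
    s : ℕ → Series
    s a = 𝒞ₛ.ν (shiftedC m a (k ℕ.+ 1)) * X ^ a
    indicator-1 : ∀ T → tc T ≡ k × nlc T ≡ j → δ (tc T) k D.* δ j (nlc T) D.≈ D.1#
    indicator-1 T (≡.refl , ≡.refl) = D.trans (D.*-cong (δ-refl (tc T)) (δ-refl (nlc T))) (D.*-identityˡ D.1#)
    indicator-0 : ∀ T → ¬ (tc T ≡ k × nlc T ≡ j) → δ (tc T) k D.* δ j (nlc T) D.≈ D.0#
    indicator-0 T ¬both with tc T ℕ.≟ k
    ... | no tc≢k  = D.trans (D.*-congʳ (δ-≢ tc≢k)) (D.zeroˡ _)
    ... | yes tc≡k = D.trans (D.*-congˡ (δ-≢ (λ j≡nlc → ¬both (tc≡k , ≡.sym j≡nlc)))) (D.zeroʳ _)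
    regroup : 𝒞ₛ.ν b * (𝒞ₛ.ν c * (1ₛ + X) ^ m) * X ^ (k ℕ.+ 1) ≈ₛ 𝒞ₛ.ν (b ℕ.* c) * Sₛ.sum {L} (s ∘ toℕ)
    regroup = Ser.trans
      (solveR 4 (λ b c x y → b :* (c :* x) :* y := b :* c :* (y :* x)) Ser.refl
        (𝒞ₛ.ν b) (𝒞ₛ.ν c) ((1ₛ + X) ^ m) (X ^ (k ℕ.+ 1)))
      (Ser.*-cong (Ser.sym (𝒞ₛ.ν-* b c)) (shifted-power m (k ℕ.+ 1) L (s≤s (ℕ.m≤m+n _ j))))

-- The identity of rational functions

module FractionIdentities (D : IntegralDomain) where
  open IntegralDomain D
  private
    module F = CommutativeRing (Fractions.commutativeRing D)
  open Fractions D using (_/_[_]; embed; cross)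
  open SemiringExp semiring using (_^_)
  open SemiringSolver commutativeSemiring using (_:+_; _:*_; _:^_; _:=_; con) renaming (solve to solveR)

  module _ (y t : Carrier) (1+y≉0 : 1# + y ≉ 0#) (1+yt≉0 : 1# + y * t ≉ 0#)
           ([y+t][1+yt]≉0 : (y + t) * (1# + y * t) ≉ 0#) where
    private
      l = (1# + y * t) / (1# + y) [ 1+y≉0 ]
      Y = ((1# + y) ^ 2 * t) / ((y + t) * (1# + y * t)) [ [y+t][1+yt]≉0 ]
      T = (y + t) / (1# + y * t) [ 1+yt≉0 ]

    llYT≈t : l F.* l F.* (Y F.* T) F.≈ embed t
    llYT≈t = cross (solveR 2 (λ y t →
      let a = con 1 :+ y :* t
          b = con 1 :+ y
      in a :* a :* (b :^ 2 :* t :* (y :+ t)) :* con 1 :=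
         t :* (b :* b :* ((y :+ t) :* a :* a))) refl y t)

    -- Rests on the factorisation (1 + yt) + (y + t) = (1 + y)(1 + t), whose first factor is the
    -- denominator of l.
    l[1+T]≈1+t : l F.* (F.1# F.+ T) F.≈ F.1# F.+ embed t
    l[1+T]≈1+t = cross (solveR 2 (λ y t →
      let a = con 1 :+ y :* t
          b = con 1 :+ y
      in a :* (con 1 :* a :+ (y :+ t) :* con 1) :* (con 1 :* con 1) :=
         (con 1 :* con 1 :+ t :* con 1) :* (b :* (con 1 :* a))) refl y t)

module RationalFunctionIdentity where
  open RationalFunctions
  open Evaluation ℚ⟨y,t⟩
  open import Relation.Binary.Reasoning.Setoid ℚ⟨y,t⟩.setoid

  Narayana-transform : ∀ n → Narayana ℚ⟨y,t⟩ (suc n) (embed t)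
    ℚ⟨y,t⟩.≈
    ((1# + y * t) / (1# + y) [ 1+y≉0 ]) ℚ⟨y,t⟩.^ (suc n ℕ.+ 1) ℚ⟨y,t⟩.*
      T⟨tc,nlc⟩ ℚ⟨y,t⟩ (suc n)
        (((1# + y) ^ 2 * t) / ((y + t) * (1# + y * t)) [ [y+t][1+yt]≉0 ])
        ((y + t) / (1# + y * t) [ 1+yt≉0 ])
  Narayana-transform n = begin
    Narayana ℚ⟨y,t⟩ (suc n) (embed t)
      ≈⟨ Narayana≈γ n (embed t) ⟩
    γ n (embed t) (ℚ⟨y,t⟩.1# ℚ⟨y,t⟩.+ embed t)
      ≈⟨ γ-cong n (llYT≈t y t 1+y≉0 1+yt≉0 [y+t][1+yt]≉0) (l[1+T]≈1+t y t 1+y≉0 1+yt≉0 [y+t][1+yt]≉0) ⟨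
    γ n (l ℚ⟨y,t⟩.* l ℚ⟨y,t⟩.* (Y ℚ⟨y,t⟩.* T)) (l ℚ⟨y,t⟩.* (ℚ⟨y,t⟩.1# ℚ⟨y,t⟩.+ T))
      ≈⟨ γ-homogeneous n l (Y ℚ⟨y,t⟩.* T) (ℚ⟨y,t⟩.1# ℚ⟨y,t⟩.+ T) ⟩
    l ℚ⟨y,t⟩.^ (suc n ℕ.+ 1) ℚ⟨y,t⟩.* γ n (Y ℚ⟨y,t⟩.* T) (ℚ⟨y,t⟩.1# ℚ⟨y,t⟩.+ T)
      ≈⟨ ℚ⟨y,t⟩.*-congˡ (T≈γ n Y T) ⟨
    l ℚ⟨y,t⟩.^ (suc n ℕ.+ 1) ℚ⟨y,t⟩.* T⟨tc,nlc⟩ ℚ⟨y,t⟩ (suc n) Y T ∎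
    where
    open FractionIdentities ℚ[y,t]-domain using (llYT≈t; l[1+T]≈1+t)
    l = (1# + y * t) / (1# + y) [ 1+y≉0 ]
    Y = ((1# + y) ^ 2 * t) / ((y + t) * (1# + y * t)) [ [y+t][1+yt]≉0 ]
    T = (y + t) / (1# + y * t) [ 1+yt≉0 ]

-- The identity of power series

module PowerSeriesIdentity where
  open PowerSeries
  open Series ℚ[y]-domain using (coeff; at)
  open Series ℚ-domain using () renaming (at to y-at)
  open Polynomial ℚ-domain using (series≈)
  open SeriesProperties ℚ[y]-domain
  private module ℚ[y][[t]]′ = IntegralDomain ℚ[y][[t]]-domain

  2≉0 : 2# ≉ 0#
  2≉0 eq with () ← y-at (series≈ (at eq 0)) 0

  y≉0 : y ≉ 0#
  y≉0 eq with () ← y-at (series≈ (at eq 0)) 1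

  1-y≉0 : 1# - y ≉ 0#
  1-y≉0 eq with () ← y-at (series≈ (at eq 0)) 0

  t≉0 : t ≉ 0#
  t≉0 eq with () ← y-at (series≈ (at eq 1)) 0

  1+t≉0 : 1# + t ≉ 0#
  1+t≉0 eq with () ← y-at (series≈ (at eq 0)) 0

  -- The equation for K with its factor t split off, in the form that `FixedPoint` solves.
  Φ : Carrier → Carrier
  Φ K = 1# - K + 2# * y * K - y * (1# - y) * (K * K)

  Φ-causal : Causal Φ
  Φ-causal = +-causal
    (+-causal (+-causal (const-causal 1#) (-‿causal id-causal)) (*-causal (const-causal (2# * y)) id-causal))
    (-‿causal (*-causal (const-causal (y * (1# - y))) (*-causal id-causal id-causal)))

  open FixedPoint Φ-causal using (fixedPoint; fixedPoint-equation)
  open QuadraticIdentities.Solution ℚ[y][[t]] y t fixedPoint fixedPoint-equation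

  -- Shows that the quotients defining u and v exist as power series, so that the identity for all
  -- parameters is not vacuous.
  parameters : Parameters √ u v
  parameters = record
    { √-constant = ℚ[y].trans (at √-constant 0)
        (ℚ[y].trans (ℚ[y].+-congˡ (X*-zero (1# - 2# * y + 2# * y * (1# - y) * fixedPoint))) (ℚ[y].+-identityʳ _))
    ; √-square   = √-square
    ; u-def      = ℚ[y][[t]]′.*-≉0 (ℚ[y][[t]]′.*-≉0 2≉0 1-y≉0) t≉0 , u-eq
    ; v-def      = ℚ[y][[t]]′.*-≉0 (ℚ[y][[t]]′.*-≉0 2≉0 y≉0) t≉0 , v-eq
    }
    where module ℚ[y] = IntegralDomain ℚ[y]-domain

  w-quotient : w IsQuotient (1# + u) / (1# + u * v)
  w-quotient = (λ 1+uv≈0 → 1+X*f≉0 ((1# - y * (1# - t) * Φ fixedPoint) * v) (trans (sym t∣uv) 1+uv≈0)) , w-eq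

  T-transform : ∀ n √ u v w → Parameters √ u v → w IsQuotient (1# + u) / (1# + u * v) →
    T⟨tc,nlc⟩ ℚ[y][[t]] (suc n) y t ≈ w ^ (suc n ℕ.+ 1) * Narayana ℚ[y][[t]] (suc n) v
  T-transform n √ u v w params w-quot = ParameterIdentities.T≈w*Narayana ℚ[y][[t]]-domain
    (ℚ-Algebra.ι ℚ[y][[t]]) (ℚ-Algebra.ι-homo ℚ[y][[t]])
    (Parameters.√-square params) (Parameters.u-def params) (Parameters.v-def params) w-quot 1+t≉0 n

-- The explicit formulas for the polynomial and for the counts

module ExplicitFormulas where
  open Binomials
  open ℚ-Fractions

  exponent : ∀ n k → suc n ∸ 2 ℕ.* k ∸ 1 ≡ n ∸ 2 ℕ.* k
  exponent n k = ≡.trans (ℕ.∸-+-assoc (suc n) (2 ℕ.* k) 1) (≡.cong (suc n ∸_) (ℕ.+-comm (2 ℕ.* k) 1))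

  catalan-* : ∀ k c → suc k ℕ.* (ballot k 0 ℕ.* c) ≡ ((2 ℕ.* k) C k) ℕ.* c
  catalan-* k c = ≡.trans (≡.sym (ℕ.*-assoc (suc k) (ballot k 0) c)) (≡.cong (ℕ._* c) (catalan k))

  module _ (A : ℚ-Algebra) where
    open ℚ-Algebra A hiding (zero)
    open Evaluation A
    open SemiringSum semiring using (sum-cong-≋)

    T-formula : ∀ n y t → T⟨tc,nlc⟩ A (suc n) y t ≈
      ∑[ i ≤ n ℕ./ 2 ]
        (let k = toℕ i in
          ι (+ (((2 ℕ.* k) C k) ℕ.* (n C (2 ℕ.* k))) ℚ./ suc k)
            * y ^ (k ℕ.+ 1) * t ^ (k ℕ.+ 1) * (1# + t) ^ (suc n ∸ 2 ℕ.* k ∸ 1))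
    T-formula n y t = trans (tree-polynomial n y t) (sum-cong-≋ {suc (n ℕ./ 2)} λ i → let k = toℕ i in
      *-cong (*-congʳ {t ^ (k ℕ.+ 1)} (*-congʳ {y ^ (k ℕ.+ 1)} (coefficient k))) (reflexive (≡.cong ((1# + t) ^_) (≡.sym (exponent n k)))))
      where
      open Coefficients commutativeSemiring using (ν)
      coefficient : ∀ k → ν (γ-coefficient n k) ≈ ι (+ (((2 ℕ.* k) C k) ℕ.* (n C (2 ℕ.* k))) ℚ./ suc k)
      coefficient k = trans (ν≈ι (γ-coefficient n k))
        (reflexive (≡.cong ι (≡.sym (exact-quotient {k} (catalan-* k (n C (2 ℕ.* k)))))))

  ν≡/1 : ∀ b → Coefficients.ν (IntegralDomain.commutativeSemiring ℚ-domain) b ≡ + b ℚ./ 1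
  ν≡/1 zero    = ≡.refl
  ν≡/1 (suc b) = ≡.trans (≡.cong (ℚ.1ℚ ℚ.+_) (ν≡/1 b)) (≡.sym (/1-suc b))

  -- Taking the coefficients of the series in ℚ puts the count and the division by k + 1 into the
  -- same ring.
  #trees-formula : ∀ n k j → + #trees (suc n) k j ℚ./ 1 ≡
    + (((2 ℕ.* k) C k) ℕ.* (n C (2 ℕ.* k)) ℕ.* ((suc n ∸ 2 ℕ.* k ∸ 1) Cℤ (j ⊖ (k ℕ.+ 1)))) ℚ./ suc k
  #trees-formula n k j = begin
    + #trees (suc n) k j ℚ./ 1        ≡⟨ ν≡/1 (#trees (suc n) k j) ⟨
    ν (#trees (suc n) k j)            ≡⟨ TreeCounts.#trees-count ℚ-domain n k j ⟩
    ν (b ℕ.* c ℕ.* s)                 ≡⟨ ν≡/1 (b ℕ.* c ℕ.* s) ⟩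
    + (b ℕ.* c ℕ.* s) ℚ./ 1           ≡⟨ exact-quotient {k} exact ⟨
    + (((2 ℕ.* k) C k) ℕ.* c ℕ.* ((suc n ∸ 2 ℕ.* k ∸ 1) Cℤ (j ⊖ (k ℕ.+ 1)))) ℚ./ suc k ∎
    where
    open ≡.≡-Reasoning
    open Coefficients (IntegralDomain.commutativeSemiring ℚ-domain) using (ν)
    b = ballot k 0
    c = n C (2 ℕ.* k)
    s = shiftedC (n ∸ 2 ℕ.* k) j (k ℕ.+ 1)
    exact : suc k ℕ.* (b ℕ.* c ℕ.* s) ≡ ((2 ℕ.* k) C k) ℕ.* c ℕ.* ((suc n ∸ 2 ℕ.* k ∸ 1) Cℤ (j ⊖ (k ℕ.+ 1)))
    exact = begin
      suc k ℕ.* (b ℕ.* c ℕ.* s)               ≡⟨ ℕ.*-assoc (suc k) (b ℕ.* c) s ⟨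
      suc k ℕ.* (b ℕ.* c) ℕ.* s               ≡⟨ ≡.cong₂ ℕ._*_ (catalan-* k c) (shiftedC≡Cℤ (n ∸ 2 ℕ.* k) j (k ℕ.+ 1)) ⟩
      ((2 ℕ.* k) C k) ℕ.* c ℕ.* ((n ∸ 2 ℕ.* k) Cℤ (j ⊖ (k ℕ.+ 1)))
        ≡⟨ ≡.cong (λ e → ((2 ℕ.* k) C k) ℕ.* c ℕ.* (e Cℤ (j ⊖ (k ℕ.+ 1)))) (exponent n k) ⟨
      ((2 ℕ.* k) C k) ℕ.* c ℕ.* ((suc n ∸ 2 ℕ.* k ∸ 1) Cℤ (j ⊖ (k ℕ.+ 1))) ∎

corollary5p8 : (n : ℕ) .{{_ : NonZero n}} →
    (let open RationalFunctions in
    Narayana ℚ⟨y,t⟩ n (embed t)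
    ℚ⟨y,t⟩.≈
    ((1# + y * t) / (1# + y) [ 1+y≉0 ]) ℚ⟨y,t⟩.^ (n ℕ.+ 1) ℚ⟨y,t⟩.*
    T⟨tc,nlc⟩ ℚ⟨y,t⟩ n
    (((1# + y) ^ 2 * t) / ((y + t) * (1# + y * t)) [ [y+t][1+yt]≉0 ])
    ((y + t) / (1# + y * t) [ 1+yt≉0 ]))
    ×
    (let open PowerSeries in
    (∃[ √ ] ∃[ u ] ∃[ v ] ∃[ w ]
    (Parameters √ u v × w IsQuotient (1# + u) / (1# + u * v)))
    ×
    (∀ √ u v w → Parameters √ u v → w IsQuotient (1# + u) / (1# + u * v) →
    T⟨tc,nlc⟩ ℚ[y][[t]] n y t ≈ w ^ (n ℕ.+ 1) * Narayana ℚ[y][[t]] n v))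
    ×
    (let open RationalFunctions in
    T⟨tc,nlc⟩ ℚ[y,t] n y t
    ≈
    ∑[ i ≤ (n ∸ 1) ℕ./ 2 ]
    (let k = toℕ i in
    ι (+ (((2 ℕ.* k) C k) ℕ.* ((n ∸ 1) C (2 ℕ.* k))) ℚ./ suc k)
    * y ^ (k ℕ.+ 1) * t ^ (k ℕ.+ 1) * (1# + t) ^ (n ∸ 2 ℕ.* k ∸ 1)))
    ×
    (∀ k j →
    + #trees n k j ℚ./ 1
    ≡
    + (((2 ℕ.* k) C k) ℕ.* ((n ∸ 1) C (2 ℕ.* k))
    ℕ.* ((n ∸ 2 ℕ.* k ∸ 1) Cℤ (j ⊖ (k ℕ.+ 1)))) ℚ./ suc k)
corollary5p8 (suc n) =
    RationalFunctionIdentity.Narayana-transform n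
  , ((_ , _ , _ , _ , PowerSeriesIdentity.parameters , PowerSeriesIdentity.w-quotient)
    , PowerSeriesIdentity.T-transform n)
  , ExplicitFormulas.T-formula ℚ[y,t] n RationalFunctions.y RationalFunctions.t
  , ExplicitFormulas.#trees-formula n
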